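{- Let $\mathrm{Sol}_{NC}$ denote the set of stable noncommutative polynomials $P=(P_n)_{n\ge0}\in\mathbb{C}\langle A\rangle$ such that for every $n\ge 2$ and every $1\le i<n$, \[ P_n(a_1,\dots,a_n)\big|_{a_{i+1}=a_i}=P_{n-2}(a_1,\dots,a_{i-1},a_{i+2},\dots,a_n). \] Then, as an algebra, $\mathrm{Sol}_{NC}$ is isomorphic to the algebra $\mathbf{WQSym}$ of word quasi-symmetric functions.
   Context: $A=\{a_1,a_2,\dots\}$ are noncommuting variables. A stable noncommutative polynomial is a sequence $P=(P_n)_{n\ge0}$ with $P_n\in\mathbb{C}\langle a_1,\dots,a_n\rangle$ (polynomials in $n$ noncommuting variables), of bounded degree, with $P_{n+1}(a_1,\dots,a_n,0)=P_n(a_1,\dots,a_n)$; these form the algebra $\mathbb{C}\langle A\rangle$. For a word $w=w_1\cdots w_k$ over the positive integers write $\mathbf{a}_w=a_{w_1}\cdots a_{w_k}$. A word $u$ is packed if whenever a letter $j+1$ occurs in $u$, the letter $j$ also occurs. The packing $\mathrm{pack}(w)$ of a word $w$ is obtained by replacing all occurrences of the smallest letter of $w$ by $1$, of the second smallest by $2$, etc. For a packed word $u$, $P_u=\sum_{w:\ \mathrm{pack}(w)=u}\mathbf{a}_w\in\mathbb{C}\langle A\rangle$, and $\mathbf{WQSym}$ is the subalgebra of $\mathbb{C}\langle A\rangle$ spanned by the $P_u$. -}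

module Defs where

open import Level using (Level; _⊔_) renaming (suc to lsuc)
open import Algebra.Bundles using (CommutativeRing)
open import Data.Nat using (ℕ; zero; suc; _<_; _≤_; _<?_)
open import Data.Nat.Properties using () renaming (_≟_ to _≟ℕ_)
open import Data.Fin using (Fin; toℕ; inject₁) renaming (zero to fzero; suc to fsuc)
open import Data.Fin.Properties using () renaming (_≟_ to _≟F_)
open import Data.List using (List; []; _∷_; _++_; map; foldr; filter; concatMap; allFin; length; deduplicate)
open import Data.List.Relation.Unary.All using (All)
open import Data.List.Membership.Propositional using (_∈_)
open import Data.Maybe using (Maybe; just; nothing)
import Data.Maybe as Maybe
open import Data.Maybe.Properties using (≡-dec)
open import Data.List.Properties using () renaming (≡-dec to List-≡-dec)
open import Data.Product using (Σ; ∃; _×_; _,_; proj₁; proj₂)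
open import Data.Sum using (_⊎_)
open import Relation.Nullary using (¬_; yes; no; does)
open import Relation.Binary.PropositionalEquality using (_≡_)
open import Data.Bool using (if_then_else_)

-- Coefficient fields: algebraically closed fields of characteristic 0
-- (the abstract algebraic properties of ℂ used)

module FieldProps {c ℓ : Level} (R : CommutativeRing c ℓ) where
  open CommutativeRing R

  IsField : Set (c ⊔ ℓ)
  IsField = (1# ≉ 0#) × (∀ x → x ≉ 0# → ∃ λ y → x * y ≈ 1#)

  natC : ℕ → Carrier
  natC zero = 0#
  natC (suc n) = 1# + natC n

  CharZero : Set ℓ
  CharZero = ∀ n → natC (suc n) ≉ 0#

  evalPoly : List Carrier → Carrier → Carrier
  evalPoly [] x = 0#
  evalPoly (a ∷ as) x = a + x * evalPoly as x

  AlgClosed : Set (c ⊔ ℓ)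
  AlgClosed = ∀ (c₀ : Carrier) (cs : List Carrier) (a : Carrier) → a ≉ 0# →
              ∃ λ x → evalPoly (c₀ ∷ cs ++ a ∷ []) x ≈ 0#

  IsAlgClosedChar0Field : Set (c ⊔ ℓ)
  IsAlgClosedChar0Field = IsField × CharZero × AlgClosed

module NC {c ℓ : Level} (R : CommutativeRing c ℓ) where
  open CommutativeRing R

  -- a word over the variables a₁,…,aₙ ; variable a_(k+1) is the letter k : Fin n
  Word : ℕ → Set
  Word n = List (Fin n)

  -- a noncommutative polynomial in n variables, given by its coefficient
  -- function on words (bounded degree is imposed separately)
  Poly : ℕ → Set c
  Poly n = Word n → Carrier

  sumL : List Carrier → Carrier
  sumL = foldr _+_ 0#

  -- substitution of each variable by a variable or by 0:
  -- σ x = just y  means  a_x ↦ a_y,   σ x = nothing  means  a_x ↦ 0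
  preimage : ∀ {m k} → (Fin m → Maybe (Fin k)) → Fin k → List (Fin m)
  preimage {m} σ y = filter (λ x → ≡-dec _≟F_ (σ x) (just y)) (allFin m)

  preimages : ∀ {m k} → (Fin m → Maybe (Fin k)) → Word k → List (Word m)
  preimages σ [] = [] ∷ []
  preimages σ (y ∷ v) = concatMap (λ x → map (x ∷_) (preimages σ v)) (preimage σ y)

  subst : ∀ {m k} → (Fin m → Maybe (Fin k)) → Poly m → Poly k
  subst σ P v = sumL (map P (preimages σ v))

  Seq : Set c
  Seq = (n : ℕ) → Poly n

  _≋_ : Seq → Seq → Set ℓ
  P ≋ Q = ∀ n (w : Word n) → P n w ≈ Q n w

  killLast : ∀ n → Fin (suc n) → Maybe (Fin n)
  killLast zero _ = nothing
  killLast (suc n) fzero = just fzero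
  killLast (suc n) (fsuc x) = Maybe.map fsuc (killLast n x)

  BoundedDegree : Seq → Set ℓ
  BoundedDegree P = ∃ λ (d : ℕ) → ∀ n (w : Word n) → d < length w → P n w ≈ 0#

  IsStable : Seq → Set ℓ
  IsStable P = BoundedDegree P × (∀ n (w : Word n) → subst (killLast n) (P (suc n)) w ≈ P n w)

  _⊕_ : Seq → Seq → Seq
  (P ⊕ Q) n w = P n w + Q n w

  _•_ : Carrier → Seq → Seq
  (a • P) n w = a * P n w

  splits : ∀ {A : Set} → List A → List (List A × List A)
  splits [] = ([] , []) ∷ []
  splits (x ∷ xs) = ([] , x ∷ xs) ∷ map (λ p → (x ∷ proj₁ p , proj₂ p)) (splits xs)

  _⊛_ : Seq → Seq → Seq
  (P ⊛ Q) n w = sumL (map (λ p → P n (proj₁ p) * Q n (proj₂ p)) (splits w))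

  𝟙 : Seq
  𝟙 n [] = 1#
  𝟙 n (_ ∷ _) = 0#

  -- Sol_NC. For n = m + 2 and 1 ≤ i < n, written i = toℕ i₀ + 1 with i₀ : Fin (m+1):
  -- P_n |_{a_{i+1} = a_i}  =  P_{n-2}(a₁,…,a_{i-1},a_{i+2},…,a_n)

  mergeVar : ∀ {m} → Fin (suc m) → Fin (suc (suc m)) → Maybe (Fin (suc (suc m)))
  mergeVar i₀ x = just (if does (x ≟F fsuc i₀) then inject₁ i₀ else x)

  skipTwo : ∀ {m} → Fin (suc m) → Fin m → Maybe (Fin (suc (suc m)))
  skipTwo i₀ j = just (if does (toℕ j <? toℕ i₀) then inject₁ (inject₁ j) else fsuc (fsuc j))

  SolCond : Seq → Set ℓ
  SolCond P = ∀ m (i₀ : Fin (suc m)) (w : Word (suc (suc m))) →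
              subst (mergeVar i₀) (P (suc (suc m))) w ≈ subst (skipTwo i₀) (P m) w

  Sol : Seq → Set ℓ
  Sol P = IsStable P × SolCond P

  -- WQSym. Words over positive integers are lists of ℕ with all letters ≥ 1.

  smallerDistinct : List ℕ → ℕ → ℕ
  smallerDistinct w x = length (filter (_<? x) (deduplicate _≟ℕ_ w))

  pack : List ℕ → List ℕ
  pack w = map (λ x → suc (smallerDistinct w x)) w

  IsPacked : List ℕ → Set
  IsPacked u = All (1 ≤_) u × (∀ j → 1 ≤ j → suc j ∈ u → j ∈ u)

  letters : ∀ {n} → Word n → List ℕ
  letters w = map (λ k → suc (toℕ k)) w

  Pu : List ℕ → Seq
  Pu u n w = if does (List-≡-dec _≟ℕ_ (pack (letters w)) u) then 1# else 0#

  linComb : List (Carrier × List ℕ) → Seq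
  linComb [] = λ n w → 0#
  linComb ((a , u) ∷ ts) = (a • Pu u) ⊕ linComb ts

  InWQSym : Seq → Set (c ⊔ ℓ)
  InWQSym P = ∃ λ (ts : List (Carrier × List ℕ)) →
              All (λ t → IsPacked (proj₂ t)) ts × (P ≋ linComb ts)

  record SolIsSubalgebra : Set (c ⊔ ℓ) where
    field
      sol-𝟙 : Sol 𝟙
      sol-⊕ : ∀ P Q → Sol P → Sol Q → Sol (P ⊕ Q)
      sol-• : ∀ a P → Sol P → Sol (a • P)
      sol-⊛ : ∀ P Q → Sol P → Sol Q → Sol (P ⊛ Q)

  record AlgIsoSolWQSym : Set (c ⊔ ℓ) where
    field
      f          : (P : Seq) → Sol P → Seq
      f-into     : ∀ P (p : Sol P) → InWQSym (f P p)
      f-resp     : ∀ P Q (p : Sol P) (q : Sol Q) → P ≋ Q → f P p ≋ f Q q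
      f-inj      : ∀ P Q (p : Sol P) (q : Sol Q) → f P p ≋ f Q q → P ≋ Q
      f-surj     : ∀ S → InWQSym S → ∃ λ P → Σ (Sol P) λ p → f P p ≋ S
      f-⊕        : ∀ P Q (p : Sol P) (q : Sol Q) (pq : Sol (P ⊕ Q)) →
                   f (P ⊕ Q) pq ≋ (f P p ⊕ f Q q)
      f-•        : ∀ a P (p : Sol P) (ap : Sol (a • P)) → f (a • P) ap ≋ (a • f P p)
      f-⊛        : ∀ P Q (p : Sol P) (q : Sol Q) (pq : Sol (P ⊛ Q)) →
                   f (P ⊛ Q) pq ≋ (f P p ⊛ f Q q)
      f-𝟙        : ∀ (e : Sol 𝟙) → f 𝟙 e ≋ 𝟙

{-# OPTIONS --safe #-}
module Submission where

-- Stability identifies a solution with a function on words over the positive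
-- integers. The isomorphism is the substitution P ↦ P(a₁, 0, a₂, 0, a₃, …), which
-- is visibly a morphism of algebras. Its image lies in WQSym: the functional
-- equation allows two consecutive unused letters to be deleted, hence one unused
-- letter after the substitution, so that coefficients depend only on the packing.
-- It is injective: after inserting two unused letters next to a letter in even
-- position of the alphabet, the equation expresses the coefficient of a word by
-- coefficients of words with fewer occurrences of such letters. It is surjective:
-- F ∈ WQSym is the image of its value at the alternating ordinal sum
-- a₁ ⊖ a₂ ⊕ a₃ ⊖ ⋯, in which a variable preceded by ⊖ contributes
-- ∑ (-1)^r F(B₁, …, B_r) over the ordered set partitions of its set of positions.
-- This is the convolution inverse of the evaluation at a single variable, which
-- gives the functional equation. Letters are numbered from 0, so that the letters
-- kept by the substitution are the even ones.

open import Defs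
open import Level using (0ℓ)
open import Algebra.Bundles using (CommutativeRing)
open import Data.Product using (_×_)
import Algebra.Properties.Ring
import Algebra.Properties.CommutativeSemigroup
open import Data.Bool using (true; false; if_then_else_)
open import Data.Fin as Fin using (Fin; toℕ; inject₁)
import Data.Fin.Properties as Fin
open import Data.List
  using (List; []; _∷_; _++_; map; filter; concatMap; length; deduplicate; allFin; applyUpTo; upTo; downFrom)
import Data.List.Properties as List
open import Data.List.Membership.Propositional using (_∈_; _∉_; find; lose)
open import Data.List.Membership.Propositional.Properties
  using (∈-filter⁺; ∈-filter⁻; ∈-deduplicate⁺; ∈-deduplicate⁻; ∈-map⁺; ∈-map⁻; ∈-allFin;
         ∈-concatMap⁻; ∈-concatMap⁺; ∈-downFrom⁻; ∈-upTo⁺)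
open import Data.List.Relation.Unary.All as All using (All; []; _∷_)
import Data.List.Relation.Unary.All.Properties as All
open import Data.List.Relation.Unary.AllPairs using (AllPairs; []; _∷_)
import Data.List.Relation.Unary.AllPairs.Properties as AllPairs
open import Data.List.Relation.Unary.Any as Any using (here; there)
open import Data.List.Relation.Unary.Unique.Propositional using (Unique)
open import Data.List.Relation.Unary.Unique.DecPropositional.Properties using (deduplicate-!)
open import Data.Maybe using (Maybe; just)
import Data.Maybe.Properties as Maybe
open import Data.Nat as ℕ using (ℕ; zero; suc; _≤_; _<_; z≤n; s≤s; _∸_; _⊓_)
open import Data.Nat.ListAction using (sum)
import Data.Nat.Properties as ℕ
open import Data.List.Membership.DecPropositional ℕ._≟_ using (_∈?_)
open import Data.Product using (∃; _,_; proj₁; proj₂)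
open import Data.Sum as Sum using (_⊎_; inj₁; inj₂)
open import Function using (_∘_; id; case_of_; _⇔_; mk⇔)
open import Relation.Binary using (Rel; IsEquivalence; tri<; tri≈; tri>)
open import Relation.Binary.PropositionalEquality as ≡
  using (_≡_; _≢_; cong; cong₂; subst; module ≡-Reasoning)
open import Relation.Nullary using (yes; no; does; ¬?; contradiction)
open import Relation.Nullary.Decidable using (does-⇔; dec-true; dec-false)
open import Relation.Unary using (Decidable)

-- On coefficients the functional equation splits in two. The first half preserves the parity of
-- letters, so it survives the passage to every second variable and does not disturb the number of
-- odd letters, the induction measure for uniqueness. The second half, once a word is read as the
-- list of position sets of its letters, is a sum over bipartitions of one set: a convolution of two
-- adjacent variables. These have opposite signs, and either sign may come first, so a two-sided
-- inverse is required. This inverse is a signed sum over ordered set partitions, which are never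
-- listed: the sum is accumulated in a functional on lists of blocks, one position at a time.

private variable
  A B C D : Set

filter-map : {P : B → Set} {Q : A → Set} (P? : Decidable P) (Q? : Decidable Q) (f : A → B) →
             (∀ x → P (f x) ⇔ Q x) → ∀ xs → filter P? (map f xs) ≡ map f (filter Q? xs)
filter-map P? Q? f eq [] = ≡.refl
filter-map P? Q? f eq (x ∷ xs)
  rewrite does-⇔ (eq x) (P? (f x)) (Q? x) with does (Q? x)
... | true  = cong (f x ∷_) (filter-map P? Q? f eq xs)
... | false = filter-map P? Q? f eq xs

-- Ranks and packing

skip : ℕ → ℕ → ℕ
skip zero    x       = suc x
skip (suc i) zero    = zero
skip (suc i) (suc x) = suc (skip i x)

skip-< : ∀ {i x} → x < i → skip i x ≡ x
skip-< {suc i} {zero}  _         = ≡.refl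
skip-< {suc i} {suc x} (s≤s x<i) = cong suc (skip-< x<i)

skip-≥ : ∀ {i x} → i ≤ x → skip i x ≡ suc x
skip-≥ z≤n       = ≡.refl
skip-≥ (s≤s i≤x) = cong suc (skip-≥ i≤x)

skip-mono-< : ∀ i {x y} → x < y → skip i x < skip i y
skip-mono-< zero    x<y = s≤s x<y
skip-mono-< (suc i) {zero}  {suc y} _         = s≤s z≤n
skip-mono-< (suc i) {suc x} {suc y} (s≤s x<y) = s≤s (skip-mono-< i x<y)

rank : List ℕ → ℕ → ℕ
rank w x = length (filter (ℕ._<? x) (deduplicate ℕ._≟_ w))

module StrictlyMonotone (φ : ℕ → ℕ) (φ-mono : ∀ {x y} → x < y → φ x < φ y) where

  φ-reflects : ∀ {x y} → φ x < φ y → x < y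
  φ-reflects {x} {y} φx<φy with ℕ.<-cmp x y
  ... | tri< x<y _ _    = x<y
  ... | tri≈ _ ≡.refl _   = contradiction φx<φy (ℕ.<-irrefl ≡.refl)
  ... | tri> _ _ y<x    = contradiction φx<φy (ℕ.<-asym (φ-mono y<x))

  φ-injective : ∀ {x y} → φ x ≡ φ y → x ≡ y
  φ-injective {x} {y} eq with ℕ.<-cmp x y
  ... | tri< x<y _ _ = contradiction eq (ℕ.<⇒≢ (φ-mono x<y))
  ... | tri≈ _ x≡y _ = x≡y
  ... | tri> _ _ y<x = contradiction (≡.sym eq) (ℕ.<⇒≢ (φ-mono y<x))

  deduplicate-map : ∀ w → deduplicate ℕ._≟_ (map φ w) ≡ map φ (deduplicate ℕ._≟_ w)
  deduplicate-map [] = ≡.refl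
  deduplicate-map (x ∷ w) rewrite deduplicate-map w = cong (φ x ∷_)
    (filter-map (¬? ∘ (φ x ℕ.≟_)) (¬? ∘ (x ℕ.≟_)) φ
      (λ y → mk⇔ (λ φx≢φy x≡y → φx≢φy (cong φ x≡y)) (λ x≢y φx≡φy → x≢y (φ-injective φx≡φy)))
      (deduplicate ℕ._≟_ w))

  rank-map : ∀ w x → rank (map φ w) (φ x) ≡ rank w x
  rank-map w x = begin
    rank (map φ w) (φ x)
      ≡⟨ cong (length ∘ filter (ℕ._<? φ x)) (deduplicate-map w) ⟩
    length (filter (ℕ._<? φ x) (map φ (deduplicate ℕ._≟_ w)))
      ≡⟨ cong length (filter-map (ℕ._<? φ x) (ℕ._<? x) φ (λ _ → mk⇔ φ-reflects φ-mono)
           (deduplicate ℕ._≟_ w)) ⟩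
    length (map φ (filter (ℕ._<? x) (deduplicate ℕ._≟_ w)))
      ≡⟨ List.length-map φ (filter (ℕ._<? x) (deduplicate ℕ._≟_ w)) ⟩
    rank w x ∎
    where open ≡-Reasoning

  map-rank-map : ∀ w → map (rank (map φ w)) (map φ w) ≡ map (rank w) w
  map-rank-map w = ≡.trans (≡.sym (List.map-∘ w)) (List.map-cong (rank-map w) w)

does-<?-suc : ∀ {x t} → x ≢ t → does (x ℕ.<? suc t) ≡ does (x ℕ.<? t)
does-<?-suc {x} {t} x≢t = does-⇔
  (mk⇔ (λ { (s≤s x≤t) → ℕ.≤∧≢⇒< x≤t x≢t }) ℕ.m<n⇒m<1+n) (x ℕ.<? suc t) (x ℕ.<? t)

count-∉ : ∀ {t} l → t ∉ l → length (filter (ℕ._<? suc t) l) ≡ length (filter (ℕ._<? t) l)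
count-∉ [] _ = ≡.refl
count-∉ {t} (x ∷ l) t∉
  rewrite does-<?-suc {x} {t} (λ x≡t → t∉ (here (≡.sym x≡t))) with does (x ℕ.<? t)
... | true  = cong suc (count-∉ l (t∉ ∘ there))
... | false = count-∉ l (t∉ ∘ there)

count-∈ : ∀ {t} l → Unique l → t ∈ l →
          length (filter (ℕ._<? suc t) l) ≡ suc (length (filter (ℕ._<? t) l))
count-∈ {t} (t ∷ l) (t≢l ∷ _) (here ≡.refl)
  rewrite dec-true (t ℕ.<? suc t) ℕ.≤-refl | dec-false (t ℕ.<? t) (ℕ.<-irrefl ≡.refl) =
  cong suc (count-∉ l (λ t∈l → All.lookup t≢l t∈l ≡.refl))
count-∈ {t} (x ∷ l) (x≢l ∷ l!) (there t∈l)
  rewrite does-<?-suc {x} {t} (All.lookup x≢l t∈l) with does (x ℕ.<? t)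
... | true  = cong suc (count-∈ l l! t∈l)
... | false = count-∈ l l! t∈l

∸-suc : ∀ {t x} → t < x → x ∸ t ≡ suc (x ∸ suc t)
∸-suc {zero}  {suc x} _         = ≡.refl
∸-suc {suc t} {suc x} (s≤s t<x) = ∸-suc t<x

module _ (w : List ℕ) where

  rank-zero : rank w 0 ≡ 0
  rank-zero = cong length (List.filter-none (ℕ._<? 0) (All.tabulate {xs = deduplicate ℕ._≟_ w} (λ _ ())))

  rank-∉ : ∀ {t} → t ∉ w → rank w (suc t) ≡ rank w t
  rank-∉ t∉w = count-∉ (deduplicate ℕ._≟_ w) (t∉w ∘ ∈-deduplicate⁻ ℕ._≟_ w)

  rank-∈ : ∀ {t} → t ∈ w → rank w (suc t) ≡ suc (rank w t)
  rank-∈ t∈w = count-∈ (deduplicate ℕ._≟_ w) (deduplicate-! ℕ._≟_ w) (∈-deduplicate⁺ ℕ._≟_ t∈w)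

  rank-≤-suc : ∀ t → rank w t ≤ rank w (suc t)
  rank-≤-suc t with t ∈? w
  ... | yes t∈w = subst (rank w t ≤_) (≡.sym (rank-∈ t∈w)) (ℕ.n≤1+n _)
  ... | no  t∉w = ℕ.≤-reflexive (≡.sym (rank-∉ t∉w))

  rank-mono : ∀ {x y} → x ℕ.≤′ y → rank w x ≤ rank w y
  rank-mono ℕ.≤′-refl        = ℕ.≤-refl
  rank-mono (ℕ.≤′-step x≤′y) = ℕ.≤-trans (rank-mono x≤′y) (rank-≤-suc _)

  rank-<  : ∀ {x y} → x ∈ w → x < y → rank w x < rank w y
  rank-< x∈w x<y = subst (_≤ rank w _) (rank-∈ x∈w) (rank-mono (ℕ.≤⇒≤′ x<y))

  -- Going down from `x`, the rank drops only on passing a letter of `w`, and then by one.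
  rank-surjective : ∀ x {k} → rank w x ≡ suc k → ∃ λ y → y ∈ w × rank w y ≡ k
  rank-surjective zero    eq = case ≡.trans (≡.sym rank-zero) eq of λ ()
  rank-surjective (suc x) eq with x ∈? w
  ... | yes x∈w = x , x∈w , ℕ.suc-injective (≡.trans (≡.sym (rank-∈ x∈w)) eq)
  ... | no  x∉w = rank-surjective x (≡.trans (≡.sym (rank-∉ x∉w)) eq)

  rank≤length : ∀ x → rank w x ≤ length w
  rank≤length x = ℕ.≤-trans (List.length-filter (ℕ._<? x) (deduplicate ℕ._≟_ w)) (dedup≤ w)
    where
    dedup≤ : ∀ u → length (deduplicate ℕ._≟_ u) ≤ length u
    dedup≤ []      = z≤n
    dedup≤ (y ∷ u) = s≤s (ℕ.≤-trans (List.length-filter (¬? ∘ (y ℕ.≟_)) (deduplicate ℕ._≟_ u)) (dedup≤ u))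

  -- Equals rank w on the letters up to t and is a translation above t, so it
  -- interpolates between the identity (t = 0) and rank w.
  partialRank : ℕ → ℕ → ℕ
  partialRank t x = rank w (x ⊓ t) ℕ.+ (x ∸ t)

  partialRank-zero : ∀ x → partialRank 0 x ≡ x
  partialRank-zero x rewrite ℕ.⊓-zeroʳ x | rank-zero = ≡.refl

  partialRank-≤ : ∀ {t x} → x ≤ t → partialRank t x ≡ rank w x
  partialRank-≤ x≤t rewrite ℕ.m≤n⇒m⊓n≡m x≤t | ℕ.m≤n⇒m∸n≡0 x≤t = ℕ.+-identityʳ _

  partialRank-≥ : ∀ {t x} → t ≤ x → partialRank t x ≡ rank w t ℕ.+ (x ∸ t)
  partialRank-≥ {t} {x} t≤x = cong (λ y → rank w y ℕ.+ (x ∸ t)) (ℕ.m≥n⇒m⊓n≡n t≤x)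

  -- Past an occurring letter the rank gains the one that the translation part loses.
  partialRank-∈ : ∀ {t} → t ∈ w → ∀ x → partialRank (suc t) x ≡ partialRank t x
  partialRank-∈ {t} t∈w x with x ℕ.≤? t
  ... | yes x≤t = ≡.trans (partialRank-≤ (ℕ.m≤n⇒m≤1+n x≤t)) (≡.sym (partialRank-≤ x≤t))
  ... | no  x≰t = begin
    partialRank (suc t) x              ≡⟨ partialRank-≥ t<x ⟩
    rank w (suc t) ℕ.+ (x ∸ suc t)     ≡⟨ cong (ℕ._+ (x ∸ suc t)) (rank-∈ t∈w) ⟩
    suc (rank w t) ℕ.+ (x ∸ suc t)     ≡⟨ ℕ.+-suc (rank w t) (x ∸ suc t) ⟨
    rank w t ℕ.+ suc (x ∸ suc t)       ≡⟨ cong (rank w t ℕ.+_) (∸-suc t<x) ⟨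
    rank w t ℕ.+ (x ∸ t)               ≡⟨ partialRank-≥ (ℕ.<⇒≤ t<x) ⟨
    partialRank t x                    ∎
    where
    open ≡-Reasoning
    t<x = ℕ.≰⇒> x≰t

  -- Letters below `t` land below `rank w t`, letters above it land beyond: the value `rank w t` is
  -- a hole, closed by the passage to `suc t`.
  partialRank-∉ : ∀ {t} → t ∉ w → ∀ {x} → x ∈ w →
                  partialRank t x ≡ skip (rank w t) (partialRank (suc t) x)
  partialRank-∉ {t} t∉w {x} x∈w with ℕ.<-cmp x t
  ... | tri≈ _ ≡.refl _ = contradiction x∈w t∉w
  ... | tri< x<t _ _  = begin
    partialRank t x                          ≡⟨ partialRank-≤ (ℕ.<⇒≤ x<t) ⟩
    rank w x                                 ≡⟨ skip-< (rank-< x∈w x<t) ⟨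
    skip (rank w t) (rank w x)
      ≡⟨ cong (skip (rank w t)) (partialRank-≤ (ℕ.m≤n⇒m≤1+n (ℕ.<⇒≤ x<t))) ⟨
    skip (rank w t) (partialRank (suc t) x)  ∎
    where open ≡-Reasoning
  ... | tri> _ _ t<x  = begin
    partialRank t x                                ≡⟨ partialRank-≥ (ℕ.<⇒≤ t<x) ⟩
    rank w t ℕ.+ (x ∸ t)                           ≡⟨ cong (rank w t ℕ.+_) (∸-suc t<x) ⟩
    rank w t ℕ.+ suc (x ∸ suc t)                   ≡⟨ ℕ.+-suc (rank w t) (x ∸ suc t) ⟩
    suc (rank w t ℕ.+ (x ∸ suc t))                 ≡⟨ skip-≥ (ℕ.m≤m+n (rank w t) _) ⟨
    skip (rank w t) (rank w t ℕ.+ (x ∸ suc t))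
      ≡⟨ cong (λ r → skip (rank w t) (r ℕ.+ (x ∸ suc t))) (rank-∉ t∉w) ⟨
    skip (rank w t) (rank w (suc t) ℕ.+ (x ∸ suc t))
      ≡⟨ cong (skip (rank w t)) (partialRank-≥ t<x) ⟨
    skip (rank w t) (partialRank (suc t) x)        ∎
    where open ≡-Reasoning

∈⇒≤sum : ∀ {x} w → x ∈ w → x ≤ sum w
∈⇒≤sum (x ∷ w) (here ≡.refl)  = ℕ.m≤m+n x (sum w)
∈⇒≤sum (y ∷ w) (there x∈w) = ℕ.≤-trans (∈⇒≤sum w x∈w) (ℕ.m≤n+m (sum w) y)

module SkipInvariance {X : Set} {_~_ : Rel X 0ℓ} (isEquivalence : IsEquivalence _~_)
  (g : List ℕ → X) (g-skip : ∀ i w → g (map (skip i) w) ~ g w) where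

  private module ~ = IsEquivalence isEquivalence

  map-partialRank : ∀ w t → g (map (partialRank w t) w) ~ g w
  map-partialRank w zero    = ~.reflexive (cong g (≡.trans (List.map-cong (partialRank-zero w) w) (List.map-id w)))
  map-partialRank w (suc t) with t ∈? w
  ... | yes t∈w = ~.trans (~.reflexive (cong g (List.map-cong (partialRank-∈ w t∈w) w))) (map-partialRank w t)
  ... | no  t∉w = ~.trans (~.sym (g-skip (rank w t) _)) (~.trans
    (~.reflexive (cong g (≡.trans (≡.sym (List.map-∘ w))
      (≡.sym (List.map-cong-local (All.tabulate (partialRank-∉ w t∉w)))))))
    (map-partialRank w t))

  -- At `t = sum w`, which bounds all letters, `partialRank` has become `rank`. The relation is left
  -- abstract because `g` is `pack` with `_≡_` in one use and a coefficient function with `_≈_` in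
  -- another.
  map-rank : ∀ w → g (map (rank w) w) ~ g w
  map-rank w = ~.trans
    (~.reflexive (cong g (≡.sym (List.map-cong-local (All.tabulate (λ x∈w → partialRank-≤ w (∈⇒≤sum w x∈w)))))))
    (map-partialRank w (sum w))

-- Choosing letters independently; merging two letters

-- The recursion of `preimages` with arbitrary fibres, so that substitutions can be carried from
-- `Fin` to ℕ.
choices : (A → List B) → List A → List (List B)
choices g []      = [] ∷ []
choices g (y ∷ w) = concatMap (λ x → map (x ∷_) (choices g w)) (g y)

map-choices : {g : A → List B} {g′ : C → List D} (f : A → C) (h : B → D) →
              (∀ y → map h (g y) ≡ g′ (f y)) →
              ∀ w → map (map h) (choices g w) ≡ choices g′ (map f w)
map-choices f h eq [] = ≡.refl
map-choices {g = g} {g′} f h eq (y ∷ w) = begin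
  map (map h) (concatMap (λ x → map (x ∷_) (choices g w)) (g y))
    ≡⟨ List.map-concatMap (map h) _ (g y) ⟩
  concatMap (λ x → map (map h) (map (x ∷_) (choices g w))) (g y)
    ≡⟨ List.concatMap-cong (λ x → ≡.trans (≡.sym (List.map-∘ (choices g w))) (List.map-∘ (choices g w))) (g y) ⟩
  concatMap (λ x → map (h x ∷_) (map (map h) (choices g w))) (g y)
    ≡⟨ List.concatMap-cong (λ x → cong (map (h x ∷_)) (map-choices f h eq w)) (g y) ⟩
  concatMap (λ x → map (h x ∷_) (choices g′ (map f w))) (g y)
    ≡⟨ List.concatMap-map _ h (g y) ⟨
  concatMap (λ x → map (x ∷_) (choices g′ (map f w))) (map h (g y))
    ≡⟨ cong (concatMap _) (eq y) ⟩
  choices g′ (map f (y ∷ w)) ∎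
  where open ≡-Reasoning

choices-empty : {g : A → List B} {w : List A} {y : A} → y ∈ w → g y ≡ [] → choices g w ≡ []
choices-empty {w = y ∷ w} (here ≡.refl) eq = cong (concatMap _) eq
choices-empty {g = g} {w = z ∷ w} (there y∈w) eq =
  ≡.trans (cong (λ us → concatMap (λ x → map (x ∷_) us) (g z)) (choices-empty y∈w eq)) (none (g z))
  where
  none : ∀ xs → concatMap (λ x → map (x ∷_) []) xs ≡ []
  none []       = ≡.refl
  none (_ ∷ xs) = none xs

choices-singleton : {g : A → List B} (φ : A → B) {w : List A} →
                    (∀ {y} → y ∈ w → g y ≡ φ y ∷ []) → choices g w ≡ map φ w ∷ []
choices-singleton φ {[]}    eq = ≡.refl
choices-singleton φ {y ∷ w} eq
  rewrite choices-singleton φ {w} (eq ∘ there) | eq (here ≡.refl) = ≡.refl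

skip₂ : ℕ → ℕ → ℕ
skip₂ i x = skip i (skip i x)

-- The fibres of the substitution of the variable `i` for the variable `suc i`.
merge : ℕ → ℕ → List ℕ
merge zero    0             = 0 ∷ 1 ∷ []
merge zero    1             = []
merge zero    (suc (suc x)) = suc (suc x) ∷ []
merge (suc i) zero          = zero ∷ []
merge (suc i) (suc x)       = map suc (merge i x)

-- The fibres of `skip₂ i`, which is the relabelling on the right-hand side of the equation.
gap : ℕ → ℕ → List ℕ
gap zero    0             = []
gap zero    1             = []
gap zero    (suc (suc x)) = x ∷ []
gap (suc i) zero          = zero ∷ []
gap (suc i) (suc x)       = map suc (gap i x)

merge-first : ∀ i → merge i i ≡ i ∷ suc i ∷ []
merge-first zero    = ≡.refl
merge-first (suc i) = cong (map suc) (merge-first i)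

merge-second : ∀ i → merge i (suc i) ≡ []
merge-second zero    = ≡.refl
merge-second (suc i) = cong (map suc) (merge-second i)

merge-other : ∀ i {x} → x ≢ i → x ≢ suc i → merge i x ≡ x ∷ []
merge-other zero    {0}           x≢0 _   = contradiction ≡.refl x≢0
merge-other zero    {1}           _   x≢1 = contradiction ≡.refl x≢1
merge-other zero    {suc (suc x)} _   _   = ≡.refl
merge-other (suc i) {zero}        _   _   = ≡.refl
merge-other (suc i) {suc x}       p   q   = cong (map suc) (merge-other i (p ∘ cong suc) (q ∘ cong suc))

gap-first : ∀ i → gap i i ≡ []
gap-first zero    = ≡.refl
gap-first (suc i) = cong (map suc) (gap-first i)

gap-second : ∀ i → gap i (suc i) ≡ []
gap-second zero    = ≡.refl
gap-second (suc i) = cong (map suc) (gap-second i)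

gap-skip₂ : ∀ i x → gap i (skip₂ i x) ≡ x ∷ []
gap-skip₂ zero    x       = ≡.refl
gap-skip₂ (suc i) zero    = ≡.refl
gap-skip₂ (suc i) (suc x) = cong (map suc) (gap-skip₂ i x)

skip₂≢first : ∀ i x → skip₂ i x ≢ i
skip₂≢first zero    x       ()
skip₂≢first (suc i) (suc x) eq = skip₂≢first i x (ℕ.suc-injective eq)

skip₂≢second : ∀ i x → skip₂ i x ≢ suc i
skip₂≢second zero    x       ()
skip₂≢second (suc i) (suc x) eq = skip₂≢second i x (ℕ.suc-injective eq)

unskip₂ : ∀ i y → y ≢ i → y ≢ suc i → ∃ λ x → skip₂ i x ≡ y
unskip₂ zero    0             y≢0 _   = contradiction ≡.refl y≢0
unskip₂ zero    1             _   y≢1 = contradiction ≡.refl y≢1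
unskip₂ zero    (suc (suc y)) _   _   = y , ≡.refl
unskip₂ (suc i) zero          _   _   = 0 , ≡.refl
unskip₂ (suc i) (suc y)       p   q   =
  let x , eq = unskip₂ i y (p ∘ cong suc) (q ∘ cong suc) in suc x , cong suc eq

unskip₂-map : ∀ i w → i ∉ w → suc i ∉ w → ∃ λ v → map (skip₂ i) v ≡ w
unskip₂-map i []      _ _ = [] , ≡.refl
unskip₂-map i (y ∷ w) p q =
  let x , eq  = unskip₂ i y (p ∘ here ∘ ≡.sym) (q ∘ here ∘ ≡.sym)
      v , eqs = unskip₂-map i w (p ∘ there) (q ∘ there)
  in x ∷ v , cong₂ _∷_ eq eqs

skip₂-< : ∀ {i x} → x < i → skip₂ i x ≡ x
skip₂-< {i} x<i = ≡.trans (cong (skip i) (skip-< x<i)) (skip-< x<i)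

skip₂-≥ : ∀ {i x} → i ≤ x → skip₂ i x ≡ suc (suc x)
skip₂-≥ {i} i≤x = ≡.trans (cong (skip i) (skip-≥ i≤x)) (skip-≥ (ℕ.m≤n⇒m≤1+n i≤x))

skip₂-<-cancel : ∀ i x {m} → i ≤ m → skip₂ i x < suc (suc m) → x < m
skip₂-<-cancel i x i≤m lt with x ℕ.<? i
... | yes x<i = ℕ.<-≤-trans x<i i≤m
... | no  x≮i = ℕ.≤-pred (ℕ.≤-pred (subst (_< _) (skip₂-≥ (ℕ.≮⇒≥ x≮i)) lt))

skip₂-injective : ∀ i {x y} → skip₂ i x ≡ skip₂ i y → x ≡ y
skip₂-injective i = S.φ-injective ∘ S.φ-injective
  where module S = StrictlyMonotone (skip i) (skip-mono-< i)

choices-merge-skip₂ : ∀ i v → choices (merge i) (map (skip₂ i) v) ≡ map (skip₂ i) v ∷ []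
choices-merge-skip₂ i v = ≡.trans
  (choices-singleton id λ y∈ → let x , _ , eq = ∈-map⁻ (skip₂ i) y∈ in
    merge-other i (skip₂≢first i x ∘ ≡.trans (≡.sym eq)) (skip₂≢second i x ∘ ≡.trans (≡.sym eq)))
  (cong (_∷ []) (List.map-id _))

choices-gap-skip₂ : ∀ i v → choices (gap i) (map (skip₂ i) v) ≡ v ∷ []
choices-gap-skip₂ i []      = ≡.refl
choices-gap-skip₂ i (x ∷ v) rewrite choices-gap-skip₂ i v | gap-skip₂ i x = ≡.refl

-- Fibres of a substitution as sorted lists

sorted-unique : ∀ {n} {xs ys : List (Fin n)} → AllPairs Fin._<_ xs → AllPairs Fin._<_ ys →
                (∀ {x} → x ∈ xs → x ∈ ys) → (∀ {x} → x ∈ ys → x ∈ xs) → xs ≡ ys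
sorted-unique {xs = []}     {[]}     _ _ _ _ = ≡.refl
sorted-unique {xs = []}     {y ∷ ys} _ _ _ q = case q (here ≡.refl) of λ ()
sorted-unique {xs = x ∷ xs} {[]}     _ _ p _ = case p (here ≡.refl) of λ ()
sorted-unique {xs = x ∷ xs} {y ∷ ys} (x<xs ∷ xs<) (y<ys ∷ ys<) p q = cong₂ _∷_ x≡y
  (sorted-unique xs< ys<
    (λ z∈xs → case p (there z∈xs) of λ where
      (here z≡y)   → contradiction (≡.trans x≡y (≡.sym z≡y)) (Fin.<⇒≢ (All.lookup x<xs z∈xs))
      (there z∈ys) → z∈ys)
    (λ z∈ys → case q (there z∈ys) of λ where
      (here z≡x)   → contradiction (≡.trans (≡.sym x≡y) (≡.sym z≡x)) (Fin.<⇒≢ (All.lookup y<ys z∈ys))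
      (there z∈xs) → z∈xs))
  where
  x≡y : x ≡ y
  x≡y with p (here ≡.refl) | q (here ≡.refl)
  ... | here eq    | _          = eq
  ... | there _    | here eq    = ≡.sym eq
  ... | there x∈ys | there y∈xs =
    contradiction (All.lookup x<xs y∈xs) (Fin.<-asym (All.lookup y<ys x∈ys))

-- The order of `allFin` makes a fibre a definite list, so checking membership is enough to compute
-- it.
filter-allFin : ∀ {n} {P : Fin n → Set} (P? : Decidable P) {xs} → AllPairs Fin._<_ xs →
                (∀ {x} → x ∈ xs → P x) → (∀ {x} → P x → x ∈ xs) → filter P? (allFin n) ≡ xs
filter-allFin P? xs< p q = sorted-unique (AllPairs.filter⁺ P? (AllPairs.tabulate⁺-< id)) xs<
  (λ x∈ → q (proj₂ (∈-filter⁻ P? {xs = allFin _} x∈))) (λ x∈ → ∈-filter⁺ P? (∈-allFin _) (p x∈))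

-- Finite sums over lists

module Sums (K : CommutativeRing 0ℓ 0ℓ) where
  open CommutativeRing K public
    using (Carrier; _≈_; _+_; _*_; -_; 0#; 1#; setoid; reflexive; +-cong; +-congˡ; +-congʳ; *-cong; *-congˡ;
           *-congʳ; -‿cong; +-identityˡ; +-identityʳ; +-assoc; +-comm; *-comm; zeroˡ; zeroʳ; distribˡ;
           -‿inverseˡ; -‿inverseʳ; *-identityʳ; refl; sym; trans; isEquivalence; ring; +-commutativeSemigroup)
  open Algebra.Properties.Ring ring public using (-0#≈0#; -‿+-comm; +-cancelˡ)
  open Algebra.Properties.CommutativeSemigroup +-commutativeSemigroup public using (interchange)
  open NC K public renaming (subst to substitute)
  open import Relation.Binary.Reasoning.Setoid setoid public

  ∑ : List A → (A → Carrier) → Carrier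
  ∑ xs f = sumL (map f xs)

  ∑-cong : ∀ (xs : List A) {f g} → (∀ {x} → x ∈ xs → f x ≈ g x) → ∑ xs f ≈ ∑ xs g
  ∑-cong []       eq = refl
  ∑-cong (x ∷ xs) eq = +-cong (eq (here ≡.refl)) (∑-cong xs (eq ∘ there))

  ∑-zero : ∀ (xs : List A) {f} → (∀ {x} → x ∈ xs → f x ≈ 0#) → ∑ xs f ≈ 0#
  ∑-zero []       eq = refl
  ∑-zero (x ∷ xs) eq = trans (+-cong (eq (here ≡.refl)) (∑-zero xs (eq ∘ there))) (+-identityˡ 0#)

  ∑-++ : ∀ (xs ys : List A) f → ∑ (xs ++ ys) f ≈ ∑ xs f + ∑ ys f
  ∑-++ []       ys f = sym (+-identityˡ _)
  ∑-++ (x ∷ xs) ys f = trans (+-congˡ (∑-++ xs ys f)) (sym (+-assoc _ _ _))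

  ∑-map : ∀ (h : A → B) xs f → ∑ (map h xs) f ≈ ∑ xs (f ∘ h)
  ∑-map h xs f = reflexive (cong sumL (≡.sym (List.map-∘ xs)))

  ∑-concatMap : ∀ (h : A → List B) xs f → ∑ (concatMap h xs) f ≈ ∑ xs (λ x → ∑ (h x) f)
  ∑-concatMap h []       f = refl
  ∑-concatMap h (x ∷ xs) f = trans (∑-++ (h x) (concatMap h xs) f) (+-congˡ (∑-concatMap h xs f))

  ∑-distrib-+ : ∀ (xs : List A) f g → ∑ xs (λ x → f x + g x) ≈ ∑ xs f + ∑ xs g
  ∑-distrib-+ []       f g = sym (+-identityˡ 0#)
  ∑-distrib-+ (x ∷ xs) f g = trans (+-congˡ (∑-distrib-+ xs f g)) (interchange _ _ _ _)

  ∑-swap : ∀ (xs : List A) (ys : List B) (f : A → B → Carrier) →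
           ∑ xs (λ x → ∑ ys (f x)) ≈ ∑ ys (λ y → ∑ xs (λ x → f x y))
  ∑-swap []       ys f = sym (∑-zero ys (λ _ → refl))
  ∑-swap (x ∷ xs) ys f = trans (+-congˡ (∑-swap xs ys f)) (sym (∑-distrib-+ ys _ _))

  *-distribˡ-∑ : ∀ a (xs : List A) f → a * ∑ xs f ≈ ∑ xs (λ x → a * f x)
  *-distribˡ-∑ a []       f = zeroʳ a
  *-distribˡ-∑ a (x ∷ xs) f = trans (distribˡ a _ _) (+-congˡ (*-distribˡ-∑ a xs f))

  *-distribʳ-∑ : ∀ a (xs : List A) f → ∑ xs f * a ≈ ∑ xs (λ x → f x * a)
  *-distribʳ-∑ a xs f = trans (*-comm _ a) (trans (*-distribˡ-∑ a xs f) (∑-cong xs (λ _ → *-comm a _)))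

  ∑-choices-∷ : ∀ (g : A → List B) y w f →
                ∑ (choices g (y ∷ w)) f ≈ ∑ (g y) (λ x → ∑ (choices g w) (λ u → f (x ∷ u)))
  ∑-choices-∷ g y w f = trans (∑-concatMap _ (g y) f) (∑-cong (g y) (λ _ → ∑-map _ (choices g w) f))

  -- Choosing letters commutes with cutting a word; this is what makes substitutions multiplicative.
  ∑-choices-splits : ∀ (g : A → List B) w (f : List B → List B → Carrier) →
    ∑ (choices g w) (λ v → ∑ (splits v) (λ p → f (proj₁ p) (proj₂ p))) ≈
    ∑ (splits w) (λ p → ∑ (choices g (proj₁ p)) (λ a → ∑ (choices g (proj₂ p)) (f a)))
  ∑-choices-splits g []      f = +-congʳ (sym (+-identityʳ _))
  ∑-choices-splits g (y ∷ w) f = begin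
    ∑ (choices g (y ∷ w)) (λ v → ∑ (splits v) (λ p → f (proj₁ p) (proj₂ p)))
      ≈⟨ ∑-choices-∷ g y w _ ⟩
    ∑ (g y) (λ x → ∑ (choices g w) (λ v → f [] (x ∷ v) + ∑ (map _ (splits v)) (λ p → f (proj₁ p) (proj₂ p))))
      ≈⟨ ∑-cong (g y) (λ _ → ∑-distrib-+ (choices g w) _ _) ⟩
    ∑ (g y) (λ x → ∑ (choices g w) (λ v → f [] (x ∷ v)) +
                   ∑ (choices g w) (λ v → ∑ (map _ (splits v)) (λ p → f (proj₁ p) (proj₂ p))))
      ≈⟨ ∑-distrib-+ (g y) _ _ ⟩
    ∑ (g y) (λ x → ∑ (choices g w) (λ v → f [] (x ∷ v))) +
    ∑ (g y) (λ x → ∑ (choices g w) (λ v → ∑ (map _ (splits v)) (λ p → f (proj₁ p) (proj₂ p))))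
      ≈⟨ +-cong (trans (sym (∑-choices-∷ g y w (f []))) (sym (+-identityʳ _))) rest ⟩
    ∑ (splits (y ∷ w)) (λ p → ∑ (choices g (proj₁ p)) (λ a → ∑ (choices g (proj₂ p)) (f a))) ∎
    where
    rest : ∑ (g y) (λ x → ∑ (choices g w) (λ v →
             ∑ (map (λ p → x ∷ proj₁ p , proj₂ p) (splits v)) (λ p → f (proj₁ p) (proj₂ p)))) ≈
           ∑ (map (λ p → y ∷ proj₁ p , proj₂ p) (splits w)) (λ p →
             ∑ (choices g (proj₁ p)) (λ a → ∑ (choices g (proj₂ p)) (f a)))
    rest = begin
      _ ≈⟨ ∑-cong (g y) (λ _ → ∑-cong (choices g w) (λ {v} _ → ∑-map _ (splits v) _)) ⟩
      ∑ (g y) (λ x → ∑ (choices g w) (λ v → ∑ (splits v) (λ p → f (x ∷ proj₁ p) (proj₂ p))))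
        ≈⟨ ∑-cong (g y) (λ {x} _ → ∑-choices-splits g w (λ a → f (x ∷ a))) ⟩
      ∑ (g y) (λ x → ∑ (splits w) (λ p → ∑ (choices g (proj₁ p)) (λ a → ∑ (choices g (proj₂ p)) (f (x ∷ a)))))
        ≈⟨ ∑-swap (g y) (splits w) _ ⟩
      ∑ (splits w) (λ p → ∑ (g y) (λ x → ∑ (choices g (proj₁ p)) (λ a → ∑ (choices g (proj₂ p)) (f (x ∷ a)))))
        ≈⟨ ∑-cong (splits w) (λ {p} _ → ∑-choices-∷ g y (proj₁ p) _) ⟨
      ∑ (splits w) (λ p → ∑ (choices g (y ∷ proj₁ p)) (λ a → ∑ (choices g (proj₂ p)) (f a)))
        ≈⟨ ∑-map _ (splits w) _ ⟨
      _ ∎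

-- Uniqueness: a solution is determined by its words with even letters

clamp : ∀ N → ℕ → Fin (suc N)
clamp N       zero    = Fin.zero
clamp zero    (suc x) = Fin.zero
clamp (suc N) (suc x) = Fin.suc (clamp N x)

toℕ-clamp : ∀ {N x} → x ≤ N → toℕ (clamp N x) ≡ x
toℕ-clamp {N}     {zero}  _         = ≡.refl
toℕ-clamp {suc N} {suc x} (s≤s x≤N) = cong suc (toℕ-clamp x≤N)

map-toℕ-clamp : ∀ {N} u → (∀ {x} → x ∈ u → x ≤ N) → map toℕ (map (clamp N) u) ≡ u
map-toℕ-clamp u u≤N = ≡.trans (≡.sym (List.map-∘ u)) (List.map-id-local (All.tabulate (toℕ-clamp ∘ u≤N)))

odd : ℕ → ℕ
odd 0             = 0
odd 1             = 1
odd (suc (suc x)) = odd x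

odd-suc : ∀ j → odd j ≡ 1 → odd (suc j) ≡ 0
odd-suc 1             _  = ≡.refl
odd-suc (suc (suc j)) eq = odd-suc j eq

odd-skip₂ : ∀ i x → odd (skip₂ i x) ≡ odd x
odd-skip₂ i x with x ℕ.<? i
... | yes x<i = cong odd (skip₂-< x<i)
... | no  x≮i = cong odd (skip₂-≥ (ℕ.≮⇒≥ x≮i))

odd-cases : ∀ x → (∃ λ y → y ℕ.* 2 ≡ x) ⊎ odd x ≡ 1
odd-cases 0             = inj₁ (0 , ≡.refl)
odd-cases 1             = inj₂ ≡.refl
odd-cases (suc (suc x)) = Sum.map₁ (λ (y , eq) → suc y , cong (suc ∘ suc) eq) (odd-cases x)

oddLetters : List ℕ → ℕ
oddLetters w = sum (map odd w)

oddLetters-cases : ∀ w → (∃ λ v → map (ℕ._* 2) v ≡ w) ⊎ (∃ λ j → j ∈ w × odd j ≡ 1)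
oddLetters-cases []      = inj₁ ([] , ≡.refl)
oddLetters-cases (x ∷ w) with odd-cases x | oddLetters-cases w
... | inj₂ eq       | _                   = inj₂ (x , here ≡.refl , eq)
... | inj₁ _        | inj₂ (j , j∈w , eq) = inj₂ (j , there j∈w , eq)
... | inj₁ (y , eq) | inj₁ (v , eqs)      = inj₁ (y ∷ v , cong₂ _∷_ eq eqs)

spread : ℕ → ℕ → ℕ
spread j x = skip (suc (suc j)) (skip j x)

spread-self : ∀ j → spread j j ≡ suc j
spread-self j = ≡.trans (cong (skip (suc (suc j))) (skip-≥ {j} ℕ.≤-refl)) (skip-< {suc (suc j)} ℕ.≤-refl)

spread-other : ∀ {j x} → x ≢ j → spread j x ≡ skip₂ j x
spread-other {j} {x} x≢j with ℕ.<-cmp x j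
... | tri< x<j _ _ = ≡.trans (cong (skip (suc (suc j))) (skip-< x<j))
  (≡.trans (skip-< (ℕ.m<n⇒m<1+n (ℕ.m<n⇒m<1+n x<j))) (≡.sym (skip₂-< x<j)))
... | tri≈ _ x≡j _ = contradiction x≡j x≢j
... | tri> _ _ j<x = ≡.trans (cong (skip (suc (suc j))) (skip-≥ (ℕ.<⇒≤ j<x)))
  (≡.trans (skip-≥ (s≤s j<x)) (≡.sym (skip₂-≥ (ℕ.<⇒≤ j<x))))

spread≢ : ∀ j x → spread j x ≢ suc (suc j)
spread≢ j x eq with x ℕ.≟ j
... | yes ≡.refl = contradiction (≡.trans (≡.sym (spread-self j)) eq) λ ()
... | no  x≢j with x ℕ.<? j
...   | yes x<j = ℕ.<⇒≢ (ℕ.m<n⇒m<1+n (ℕ.m<n⇒m<1+n x<j))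
  (≡.trans (≡.sym (≡.trans (spread-other x≢j) (skip₂-< x<j))) eq)
...   | no  x≮j = x≢j (ℕ.suc-injective (ℕ.suc-injective
  (≡.trans (≡.sym (≡.trans (spread-other x≢j) (skip₂-≥ (ℕ.≮⇒≥ x≮j)))) eq)))

merge-spread-self : ∀ j → merge (suc j) (spread j j) ≡ suc j ∷ suc (suc j) ∷ []
merge-spread-self j = ≡.trans (cong (merge (suc j)) (spread-self j)) (merge-first (suc j))

merge-spread-other : ∀ {j x} → x ≢ j → merge (suc j) (spread j x) ≡ skip₂ j x ∷ []
merge-spread-other {j} {x} x≢j = ≡.trans (cong (merge (suc j)) (spread-other x≢j))
  (merge-other (suc j) (skip₂≢second j x) (subst (_≢ suc (suc j)) (spread-other x≢j) (spread≢ j x)))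

module Restriction (K : CommutativeRing 0ℓ 0ℓ) where
  open Sums K

  -- The coefficient at `w` of the functional equation, with the number of variables removed.
  Balanced : (List ℕ → Carrier) → Set
  Balanced F = ∀ i w → ∑ (choices (merge i) w) F ≈ ∑ (choices (gap i) w) F

  -- A word that omits `i` and `suc i` has exactly one preimage on either side.
  balanced-skip₂ : ∀ {F} → Balanced F → ∀ i v → F (map (skip₂ i) v) ≈ F v
  balanced-skip₂ {F} F-balanced i v = begin
    F (map (skip₂ i) v)                              ≈⟨ +-identityʳ _ ⟨
    ∑ (map (skip₂ i) v ∷ []) F                       ≡⟨ cong (λ us → ∑ us F) (choices-merge-skip₂ i v) ⟨
    ∑ (choices (merge i) (map (skip₂ i) v)) F        ≈⟨ F-balanced i (map (skip₂ i) v) ⟩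
    ∑ (choices (gap i) (map (skip₂ i) v)) F          ≡⟨ cong (λ us → ∑ us F) (choices-gap-skip₂ i v) ⟩
    ∑ (v ∷ []) F                                     ≈⟨ +-identityʳ _ ⟩
    F v                                              ∎

  balanced-∈ : ∀ {F} → Balanced F → ∀ {i w} → i ∈ w → ∑ (choices (merge i) w) F ≈ 0#
  balanced-∈ {F} F-balanced {i} {w} i∈w =
    trans (F-balanced i w) (reflexive (cong (λ us → ∑ us F) (choices-empty i∈w (gap-first i))))

  module _ {j : ℕ} (j-odd : odd j ≡ 1) where

    private
      -- Each occurrence of the odd letter `j` becomes independently the even `suc j` or the odd
      -- `suc (suc j)`. Choosing the odd letter throughout gives `map (skip₂ j) w`; every other
      -- expansion has fewer odd letters than `w`.
      expansions : List ℕ → List (List ℕ)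
      expansions w = choices (merge (suc j)) (map (spread j) w)

    ∑-expansions-self : ∀ w F → ∑ (expansions (j ∷ w)) F ≈
      ∑ (expansions w) (λ u → F (suc j ∷ u)) + ∑ (expansions w) (λ u → F (suc (suc j) ∷ u))
    ∑-expansions-self w F = begin
      ∑ (expansions (j ∷ w)) F
        ≈⟨ ∑-choices-∷ (merge (suc j)) (spread j j) (map (spread j) w) F ⟩
      ∑ (merge (suc j) (spread j j)) (λ x → ∑ (expansions w) (λ u → F (x ∷ u)))
        ≡⟨ cong (λ xs → ∑ xs (λ x → ∑ (expansions w) (λ u → F (x ∷ u)))) (merge-spread-self j) ⟩
      ∑ (expansions w) (λ u → F (suc j ∷ u)) + (∑ (expansions w) (λ u → F (suc (suc j) ∷ u)) + 0#)
        ≈⟨ +-congˡ (+-identityʳ _) ⟩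
      _ ∎

    ∑-expansions-other : ∀ {x} → x ≢ j → ∀ w F →
      ∑ (expansions (x ∷ w)) F ≈ ∑ (expansions w) (λ u → F (skip₂ j x ∷ u))
    ∑-expansions-other {x} x≢j w F = begin
      ∑ (expansions (x ∷ w)) F
        ≈⟨ ∑-choices-∷ (merge (suc j)) (spread j x) (map (spread j) w) F ⟩
      ∑ (merge (suc j) (spread j x)) (λ y → ∑ (expansions w) (λ u → F (y ∷ u)))
        ≡⟨ cong (λ xs → ∑ xs (λ x → ∑ (expansions w) (λ u → F (x ∷ u)))) (merge-spread-other x≢j) ⟩
      ∑ (expansions w) (λ u → F (skip₂ j x ∷ u)) + 0#
        ≈⟨ +-identityʳ _ ⟩
      _ ∎

    private
      oddLetters-skip₂-∷ : ∀ x u w → oddLetters u < oddLetters w →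
                           oddLetters (skip₂ j x ∷ u) < oddLetters (x ∷ w)
      oddLetters-skip₂-∷ x u w u<w rewrite odd-skip₂ j x = ℕ.+-monoʳ-< (odd x) u<w

      oddLetters-suc-∷ : ∀ u w → oddLetters u ≤ oddLetters w → oddLetters (suc j ∷ u) < oddLetters (j ∷ w)
      oddLetters-suc-∷ u w u≤w rewrite odd-suc j j-odd | j-odd = s≤s u≤w

      skip₂-self : skip₂ j j ≡ suc (suc j)
      skip₂-self = skip₂-≥ {j} ℕ.≤-refl

    expansions-cong : ∀ w {F G} → (∀ u → oddLetters u ≤ oddLetters w → F u ≈ G u) →
                      ∑ (expansions w) F ≈ ∑ (expansions w) G
    expansions-cong []      eq = +-congʳ (eq [] z≤n)
    expansions-cong (x ∷ w) {F} {G} eq with x ℕ.≟ j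
    ... | yes ≡.refl = begin
      ∑ (expansions (j ∷ w)) F
        ≈⟨ ∑-expansions-self w F ⟩
      ∑ (expansions w) (F ∘ (suc j ∷_)) + ∑ (expansions w) (F ∘ (suc (suc j) ∷_))
        ≈⟨ +-cong (expansions-cong w (λ u u≤ → eq (suc j ∷ u) (ℕ.<⇒≤ (oddLetters-suc-∷ u w u≤))))
                  (expansions-cong w (λ u u≤ → eq (suc (suc j) ∷ u) (ℕ.+-monoʳ-≤ (odd j) u≤))) ⟩
      ∑ (expansions w) (G ∘ (suc j ∷_)) + ∑ (expansions w) (G ∘ (suc (suc j) ∷_))
        ≈⟨ ∑-expansions-self w G ⟨
      ∑ (expansions (j ∷ w)) G ∎
    ... | no x≢j = begin
      ∑ (expansions (x ∷ w)) F
        ≈⟨ ∑-expansions-other x≢j w F ⟩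
      ∑ (expansions w) (F ∘ (skip₂ j x ∷_))
        ≈⟨ expansions-cong w (λ u u≤ → eq _ (ℕ.+-mono-≤ (ℕ.≤-reflexive (odd-skip₂ j x)) u≤)) ⟩
      ∑ (expansions w) (G ∘ (skip₂ j x ∷_))
        ≈⟨ ∑-expansions-other x≢j w G ⟨
      ∑ (expansions (x ∷ w)) G ∎

    -- The hypothesis kills every expansion except the one that moves all
    -- occurrences of suc j to suc (suc j).
    expansions-determine : ∀ w {F G} → (∀ u → oddLetters u < oddLetters w → F u ≈ G u) →
      ∑ (expansions w) F ≈ ∑ (expansions w) G → F (map (skip₂ j) w) ≈ G (map (skip₂ j) w)
    expansions-determine []      _ eq = trans (sym (+-identityʳ _)) (trans eq (+-identityʳ _))
    expansions-determine (x ∷ w) {F} {G} low eq with x ℕ.≟ j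
    ... | yes ≡.refl = expansions-determine w (λ u u<w → low _ (oddLetters-skip₂-∷ j u w u<w))
      (subst (λ y → ∑ (expansions w) (F ∘ (y ∷_)) ≈ ∑ (expansions w) (G ∘ (y ∷_))) (≡.sym skip₂-self)
        (+-cancelˡ _ _ _ (begin
          ∑ (expansions w) (F ∘ (suc j ∷_)) + ∑ (expansions w) (F ∘ (suc (suc j) ∷_))
            ≈⟨ ∑-expansions-self w F ⟨
          ∑ (expansions (j ∷ w)) F
            ≈⟨ eq ⟩
          ∑ (expansions (j ∷ w)) G
            ≈⟨ ∑-expansions-self w G ⟩
          ∑ (expansions w) (G ∘ (suc j ∷_)) + ∑ (expansions w) (G ∘ (suc (suc j) ∷_))
            ≈⟨ +-congʳ (expansions-cong w (λ u u≤ → low _ (oddLetters-suc-∷ u w u≤))) ⟨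
          ∑ (expansions w) (F ∘ (suc j ∷_)) + ∑ (expansions w) (G ∘ (suc (suc j) ∷_)) ∎)))
    ... | no x≢j = expansions-determine w (λ u u<w → low _ (oddLetters-skip₂-∷ x u w u<w))
      (trans (sym (∑-expansions-other x≢j w F)) (trans eq (∑-expansions-other x≢j w G)))

  -- Induction on the number of odd letters; a word without any is a doubled word, where `F` and `G`
  -- agree by hypothesis.
  balanced-unique : ∀ {F G} → Balanced F → Balanced G →
                    (∀ v → F (map (ℕ._* 2) v) ≈ G (map (ℕ._* 2) v)) → ∀ w → F w ≈ G w
  balanced-unique {F} {G} F-balanced G-balanced even w = go (suc (oddLetters w)) w ℕ.≤-refl
    where
    go : ∀ n w → oddLetters w < n → F w ≈ G w
    go (suc n) w (s≤s w≤n) with oddLetters-cases w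
    ... | inj₁ (v , ≡.refl)     = even v
    -- Since `suc j` occurs in `map (spread j) w`, the sum over the expansions vanishes for `F` and
    -- for `G`. Opening a pair at `j` first brings `w` to the form of the all-odd expansion.
    ... | inj₂ (j , j∈w , j-odd) = begin
      F w                   ≈⟨ balanced-skip₂ F-balanced j w ⟨
      F (map (skip₂ j) w)   ≈⟨ expansions-determine j-odd w (λ u u<w → go n u (ℕ.<-≤-trans u<w w≤n))
                                 (trans (balanced-∈ F-balanced sj∈) (sym (balanced-∈ G-balanced sj∈))) ⟩
      G (map (skip₂ j) w)   ≈⟨ balanced-skip₂ G-balanced j w ⟩
      G w                   ∎
      where
      sj∈ : suc j ∈ map (spread j) w
      sj∈ = subst (_∈ map (spread j) w) (spread-self j) (∈-map⁺ (spread j) j∈w)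

-- The functional equation on words, and the subalgebra of solutions

module Solutions (K : CommutativeRing 0ℓ 0ℓ) where
  open Sums K public
  open Restriction K public

  preimages≡choices : ∀ {m k} (σ : Fin m → Maybe (Fin k)) w → preimages σ w ≡ choices (preimage σ) w
  preimages≡choices σ []      = ≡.refl
  preimages≡choices σ (y ∷ w) =
    cong (λ us → concatMap (λ x → map (x ∷_) us) (preimage σ y)) (preimages≡choices σ w)

  preimage≡ : ∀ {m k} (σ : Fin m → Maybe (Fin k)) y {xs} → AllPairs Fin._<_ xs →
              (∀ {x} → x ∈ xs → σ x ≡ just y) → (∀ {x} → σ x ≡ just y → x ∈ xs) → preimage σ y ≡ xs
  preimage≡ σ y = filter-allFin (λ x → Maybe.≡-dec Fin._≟_ (σ x) (just y))

  mergeVar-second : ∀ {m} (i : Fin (suc m)) → mergeVar i (Fin.suc i) ≡ just (inject₁ i)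
  mergeVar-second i rewrite dec-true (Fin.suc i Fin.≟ Fin.suc i) ≡.refl = ≡.refl

  mergeVar-other : ∀ {m} (i : Fin (suc m)) {x} → x ≢ Fin.suc i → mergeVar i x ≡ just x
  mergeVar-other i {x} x≢ rewrite dec-false (x Fin.≟ Fin.suc i) x≢ = ≡.refl

  inject₁≢suc : ∀ {m} (i : Fin m) → inject₁ i ≢ Fin.suc i
  inject₁≢suc i eq = ℕ.1+n≢n (≡.trans (cong toℕ (≡.sym eq)) (Fin.toℕ-inject₁ i))

  mergeVar-fibre : ∀ {m} (i : Fin (suc m)) {x y} → mergeVar i x ≡ just y →
                   (x ≡ Fin.suc i × y ≡ inject₁ i) ⊎ (x ≢ Fin.suc i × y ≡ x)
  mergeVar-fibre i {x} eq with x Fin.≟ Fin.suc i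
  ... | yes x≡ = inj₁ (x≡ , ≡.sym (Maybe.just-injective eq))
  ... | no  x≢ = inj₂ (x≢ , ≡.sym (Maybe.just-injective eq))

  preimage-mergeVar : ∀ {m} (i : Fin (suc m)) y →
                      map toℕ (preimage (mergeVar i) y) ≡ merge (toℕ i) (toℕ y)
  preimage-mergeVar i y with y Fin.≟ inject₁ i | y Fin.≟ Fin.suc i
  ... | yes ≡.refl | _ = ≡.trans
    (cong (map toℕ) (preimage≡ (mergeVar i) (inject₁ i) ((s≤s (ℕ.≤-reflexive (Fin.toℕ-inject₁ i)) ∷ []) ∷ [] ∷ [])
      (λ { (here ≡.refl)         → mergeVar-other i {inject₁ i} (inject₁≢suc i)
         ; (there (here ≡.refl)) → mergeVar-second i })
      (λ {x} eq → case mergeVar-fibre i {x} eq of λ where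
        (inj₁ (x≡ , _)) → there (here x≡)
        (inj₂ (_ , y≡)) → here (≡.sym y≡))))
    (≡.trans (cong (λ a → a ∷ suc (toℕ i) ∷ []) (Fin.toℕ-inject₁ i))
      (≡.trans (≡.sym (merge-first (toℕ i))) (cong (merge (toℕ i)) (≡.sym (Fin.toℕ-inject₁ i)))))
  ... | no _ | yes ≡.refl = ≡.trans
    (cong (map toℕ) (preimage≡ (mergeVar i) (Fin.suc i) [] (λ ())
      (λ {x} eq → case mergeVar-fibre i {x} eq of λ where
        (inj₁ (_ , y≡))  → contradiction (≡.sym y≡) (inject₁≢suc i)
        (inj₂ (x≢ , y≡)) → contradiction (≡.sym y≡) x≢)))
    (≡.sym (merge-second (toℕ i)))
  ... | no y≢first | no y≢second = ≡.trans
    (cong (map toℕ) (preimage≡ (mergeVar i) y ([] ∷ [])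
      (λ { (here ≡.refl) → mergeVar-other i y≢second })
      (λ {x} eq → case mergeVar-fibre i {x} eq of λ where
        (inj₁ (_ , y≡)) → contradiction y≡ y≢first
        (inj₂ (_ , y≡)) → here (≡.sym y≡))))
    (≡.sym (merge-other (toℕ i)
      (λ eq → y≢first (Fin.toℕ-injective (≡.trans eq (≡.sym (Fin.toℕ-inject₁ i)))))
      (λ eq → y≢second (Fin.toℕ-injective eq))))

  skipTwo-skip₂ : ∀ {m} (i : Fin (suc m)) j → ∃ λ z → skipTwo i j ≡ just z × toℕ z ≡ skip₂ (toℕ i) (toℕ j)
  skipTwo-skip₂ i j with toℕ j ℕ.<? toℕ i
  ... | yes j<i rewrite dec-true (toℕ j ℕ.<? toℕ i) j<i =
    _ , ≡.refl , ≡.trans (≡.trans (Fin.toℕ-inject₁ _) (Fin.toℕ-inject₁ j)) (≡.sym (skip₂-< j<i))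
  ... | no  j≮i rewrite dec-false (toℕ j ℕ.<? toℕ i) j≮i = _ , ≡.refl , ≡.sym (skip₂-≥ (ℕ.≮⇒≥ j≮i))

  skipTwo⇒skip₂ : ∀ {m} (i : Fin (suc m)) {j y} → skipTwo i j ≡ just y → skip₂ (toℕ i) (toℕ j) ≡ toℕ y
  skipTwo⇒skip₂ i {j} eq = let z , eqz , toℕz = skipTwo-skip₂ i j in
    ≡.trans (≡.sym toℕz) (cong toℕ (Maybe.just-injective (≡.trans (≡.sym eqz) eq)))

  skip₂⇒skipTwo : ∀ {m} (i : Fin (suc m)) {j y} → skip₂ (toℕ i) (toℕ j) ≡ toℕ y → skipTwo i j ≡ just y
  skip₂⇒skipTwo i {j} eq = let z , eqz , toℕz = skipTwo-skip₂ i j in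
    ≡.trans eqz (cong just (Fin.toℕ-injective (≡.trans toℕz eq)))

  preimage-skipTwo : ∀ {m} (i : Fin (suc m)) y →
                     map toℕ (preimage (skipTwo i) y) ≡ gap (toℕ i) (toℕ y)
  preimage-skipTwo i y with toℕ y ℕ.≟ toℕ i | toℕ y ℕ.≟ suc (toℕ i)
  ... | yes y≡ | _ = ≡.trans
    (cong (map toℕ) (preimage≡ (skipTwo i) y [] (λ ())
      (λ {j} eq → contradiction (≡.trans (skipTwo⇒skip₂ i eq) y≡) (skip₂≢first (toℕ i) (toℕ j)))))
    (≡.sym (≡.trans (cong (gap (toℕ i)) y≡) (gap-first (toℕ i))))
  ... | no _ | yes y≡ = ≡.trans
    (cong (map toℕ) (preimage≡ (skipTwo i) y [] (λ ())
      (λ {j} eq → contradiction (≡.trans (skipTwo⇒skip₂ i eq) y≡) (skip₂≢second (toℕ i) (toℕ j)))))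
    (≡.sym (≡.trans (cong (gap (toℕ i)) y≡) (gap-second (toℕ i))))
  ... | no y≢first | no y≢second with unskip₂ (toℕ i) (toℕ y) y≢first y≢second
  ...   | x , eq = ≡.trans
    (cong (map toℕ) (preimage≡ (skipTwo i) y ([] ∷ [])
      (λ { (here ≡.refl) → skip₂⇒skipTwo i (≡.trans (cong (skip₂ (toℕ i)) (Fin.toℕ-fromℕ< x<m)) eq) })
      (λ {j} eq′ → here (Fin.toℕ-injective (≡.trans
        (skip₂-injective (toℕ i) (≡.trans (skipTwo⇒skip₂ i eq′) (≡.sym eq)))
        (≡.sym (Fin.toℕ-fromℕ< x<m)))))))
    (≡.trans (cong (_∷ []) (Fin.toℕ-fromℕ< x<m))
      (≡.trans (≡.sym (gap-skip₂ (toℕ i) x)) (cong (gap (toℕ i)) eq)))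
    where
    x<m = skip₂-<-cancel (toℕ i) x (ℕ.≤-pred (Fin.toℕ<n i))
            (subst (_< _) (≡.sym eq) (Fin.toℕ<n y))

  killLast-inject₁ : ∀ n y → killLast n (inject₁ y) ≡ just y
  killLast-inject₁ (suc n) Fin.zero    = ≡.refl
  killLast-inject₁ (suc n) (Fin.suc y) rewrite killLast-inject₁ n y = ≡.refl

  killLast-fibre : ∀ n x {y} → killLast n x ≡ just y → x ≡ inject₁ y
  killLast-fibre (suc n) Fin.zero    ≡.refl = ≡.refl
  killLast-fibre (suc n) (Fin.suc x) eq with killLast n x in eqx
  killLast-fibre (suc n) (Fin.suc x) ≡.refl | just y = cong Fin.suc (killLast-fibre n x eqx)

  preimage-killLast : ∀ n y → preimage (killLast n) y ≡ inject₁ y ∷ []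
  preimage-killLast n y = preimage≡ (killLast n) y ([] ∷ [])
    (λ { (here ≡.refl) → killLast-inject₁ n y }) (λ {x} eq → here (killLast-fibre n x eq))

  substitute-killLast : ∀ n (p : Poly (suc n)) w → substitute (killLast n) p w ≈ p (map inject₁ w)
  substitute-killLast n p w = begin
    sumL (map p (preimages (killLast n) w))
      ≡⟨ cong (sumL ∘ map p) (≡.trans (preimages≡choices (killLast n) w)
           (choices-singleton inject₁ {w} (λ {y} _ → preimage-killLast n y))) ⟩
    p (map inject₁ w) + 0#
      ≈⟨ +-identityʳ _ ⟩
    p (map inject₁ w) ∎

  -- Passage from finitely many variables to words over ℕ: only the fibres, read through `toℕ`,
  -- matter.
  substitute≈∑ : ∀ {m k} (σ : Fin m → Maybe (Fin k)) {g : ℕ → List ℕ} →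
                 (∀ y → map toℕ (preimage σ y) ≡ g (toℕ y)) →
                 ∀ (p : Poly m) {F} → (∀ w → p w ≈ F (map toℕ w)) →
                 ∀ w → substitute σ p w ≈ ∑ (choices g (map toℕ w)) F
  substitute≈∑ σ {g} eq p {F} p≈F w = begin
    ∑ (preimages σ w) p                         ≈⟨ ∑-cong (preimages σ w) (λ {u} _ → p≈F u) ⟩
    ∑ (preimages σ w) (F ∘ map toℕ)             ≈⟨ ∑-map (map toℕ) (preimages σ w) F ⟨
    ∑ (map (map toℕ) (preimages σ w)) F         ≡⟨ cong (λ us → ∑ (map (map toℕ) us) F) (preimages≡choices σ w) ⟩
    ∑ (map (map toℕ) (choices (preimage σ) w)) F
      ≡⟨ cong (λ us → ∑ us F) (map-choices toℕ toℕ eq w) ⟩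
    ∑ (choices g (map toℕ w)) F                 ∎

  Extends : (List ℕ → Carrier) → Seq → Set
  Extends F P = ∀ n (w : Word n) → P n w ≈ F (map toℕ w)

  -- The sum of the letters is a crude bound for each of them, so `clamp` truncates nothing; by
  -- stability any larger number of variables would give the same value.
  extension : Seq → List ℕ → Carrier
  extension P u = P (suc (sum u)) (map (clamp (sum u)) u)

  module _ {P : Seq} (stable : IsStable P) where

    stable-inject : ∀ n w → P (suc n) (map inject₁ w) ≈ P n w
    stable-inject n w = trans (sym (substitute-killLast n (P (suc n)) w)) (proj₂ stable n w)

    -- The order `_≤‴_` recurs by raising its lower end, as `stable-inject` does.
    stable-≤ : ∀ {n N} → n ℕ.≤‴ N → ∀ w w′ → map toℕ w ≡ map toℕ w′ → P n w ≈ P N w′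
    stable-≤ ℕ.≤‴-refl w w′ eq = reflexive (cong (P _) (List.map-injective Fin.toℕ-injective eq))
    stable-≤ {n} (ℕ.≤‴-step n<N) w w′ eq = trans (sym (stable-inject n w))
      (stable-≤ n<N (map inject₁ w) w′
        (≡.trans (≡.trans (≡.sym (List.map-∘ w)) (List.map-cong Fin.toℕ-inject₁ w)) eq))

    extends : Extends (extension P) P
    extends n w with ℕ.≤-total n (suc (sum (map toℕ w)))
    ... | inj₁ n≤N = stable-≤ (ℕ.≤⇒≤‴ n≤N) w (map (clamp _) (map toℕ w)) (≡.sym (map-toℕ-clamp _ (∈⇒≤sum _)))
    ... | inj₂ N≤n = sym (stable-≤ (ℕ.≤⇒≤‴ N≤n) (map (clamp _) (map toℕ w)) w (map-toℕ-clamp _ (∈⇒≤sum _)))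

    extension-balanced : SolCond P → Balanced (extension P)
    extension-balanced sol i u = begin
      ∑ (choices (merge i) u) (extension P)
        ≡⟨ cong₂ (λ j v → ∑ (choices (merge j) v) (extension P)) toℕi₀ toℕw ⟨
      ∑ (choices (merge (toℕ i₀)) (map toℕ w)) (extension P)
        ≈⟨ substitute≈∑ (mergeVar i₀) (preimage-mergeVar i₀) (P (suc (suc m))) (extends _) w ⟨
      substitute (mergeVar i₀) (P (suc (suc m))) w
        ≈⟨ sol m i₀ w ⟩
      substitute (skipTwo i₀) (P m) w
        ≈⟨ substitute≈∑ (skipTwo i₀) (preimage-skipTwo i₀) (P m) (extends _) w ⟩
      ∑ (choices (gap (toℕ i₀)) (map toℕ w)) (extension P)
        ≡⟨ cong₂ (λ j v → ∑ (choices (gap j) v) (extension P)) toℕi₀ toℕw ⟩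
      ∑ (choices (gap i) u) (extension P) ∎
      where
      -- With `suc (suc m)` variables there is room for `i`, for `suc i` and for every letter of
      -- `u`.
      m     = i ℕ.+ sum u
      i₀    = clamp m i
      toℕi₀ : toℕ i₀ ≡ i
      toℕi₀ = toℕ-clamp (ℕ.m≤m+n i (sum u))
      w     = map (clamp (suc m)) u
      toℕw  : map toℕ w ≡ u
      toℕw  = map-toℕ-clamp u (λ x∈u → ℕ.≤-trans (∈⇒≤sum u x∈u) (ℕ.m≤n⇒m≤1+n (ℕ.m≤n+m (sum u) i)))

  ∑-*-∑ : ∀ {A B : Set} (xs : List A) (ys : List B) f g → ∑ xs (λ x → ∑ ys (λ y → f x * g y)) ≈ ∑ xs f * ∑ ys g
  ∑-*-∑ xs ys f g = trans (∑-cong xs (λ _ → sym (*-distribˡ-∑ _ ys g))) (sym (*-distribʳ-∑ _ xs f))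

  substitute-⊕ : ∀ {m k} (σ : Fin m → Maybe (Fin k)) P Q w →
                 substitute σ ((P ⊕ Q) m) w ≈ substitute σ (P m) w + substitute σ (Q m) w
  substitute-⊕ σ P Q w = ∑-distrib-+ (preimages σ w) _ _

  substitute-• : ∀ {m k} (σ : Fin m → Maybe (Fin k)) a P w →
                 substitute σ ((a • P) m) w ≈ a * substitute σ (P m) w
  substitute-• σ a P w = sym (*-distribˡ-∑ a (preimages σ w) _)

  substitute-⊛ : ∀ {m k} (σ : Fin m → Maybe (Fin k)) P Q w →
    substitute σ ((P ⊛ Q) m) w ≈
    ∑ (splits w) (λ s → substitute σ (P m) (proj₁ s) * substitute σ (Q m) (proj₂ s))
  substitute-⊛ {m} σ P Q w = begin
    ∑ (preimages σ w) ((P ⊛ Q) m)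
      ≡⟨ cong (λ us → ∑ us ((P ⊛ Q) m)) (preimages≡choices σ w) ⟩
    ∑ (choices (preimage σ) w) ((P ⊛ Q) m)
      ≈⟨ ∑-choices-splits (preimage σ) w (λ a b → P m a * Q m b) ⟩
    ∑ (splits w) (λ s → ∑ (choices (preimage σ) (proj₁ s)) (λ a →
      ∑ (choices (preimage σ) (proj₂ s)) (λ b → P m a * Q m b)))
      ≈⟨ ∑-cong (splits w) (λ {s} _ → trans
           (∑-*-∑ (choices (preimage σ) (proj₁ s)) (choices (preimage σ) (proj₂ s)) (P m) (Q m))
           (reflexive (cong₂ (λ us vs → ∑ us (P m) * ∑ vs (Q m))
             (≡.sym (preimages≡choices σ (proj₁ s))) (≡.sym (preimages≡choices σ (proj₂ s)))))) ⟩
    _ ∎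

  substitute-𝟙 : ∀ {m k} (σ : Fin m → Maybe (Fin k)) w → substitute σ (𝟙 m) w ≈ 𝟙 k w
  substitute-𝟙 σ []      = +-identityʳ 1#
  substitute-𝟙 σ (y ∷ w) = begin
    ∑ (preimages σ (y ∷ w)) (𝟙 _)
      ≈⟨ ∑-concatMap _ (preimage σ y) (𝟙 _) ⟩
    ∑ (preimage σ y) (λ x → ∑ (map (x ∷_) (preimages σ w)) (𝟙 _))
      ≈⟨ ∑-zero (preimage σ y) (λ {x} _ →
           trans (∑-map (x ∷_) (preimages σ w) (𝟙 _)) (∑-zero (preimages σ w) (λ _ → refl))) ⟩
    0# ∎

  length-splits : ∀ {A : Set} (w : List A) {s} → s ∈ splits w → length (proj₁ s) ℕ.+ length (proj₂ s) ≡ length w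
  length-splits []      (here ≡.refl) = ≡.refl
  length-splits (x ∷ w) (here ≡.refl) = ≡.refl
  length-splits (x ∷ w) (there s∈)    with t , t∈ , ≡.refl ← ∈-map⁻ _ s∈ = cong suc (length-splits w t∈)

  ⊛-boundedDegree : ∀ P Q → BoundedDegree P → BoundedDegree Q → BoundedDegree (P ⊛ Q)
  ⊛-boundedDegree P Q (d , Pd) (e , Qe) = d ℕ.+ e , λ n w de< → ∑-zero (splits w) λ {s} s∈ →
    case d ℕ.<? length (proj₁ s) of λ where
      (yes d<) → trans (*-congʳ (Pd n (proj₁ s) d<)) (zeroˡ _)
      (no  d≮) → trans (*-congˡ (Qe n (proj₂ s) (ℕ.≰⇒> λ ≤e → ℕ.<⇒≱ de<
        (subst (ℕ._≤ d ℕ.+ e) (length-splits w s∈) (ℕ.+-mono-≤ (ℕ.≮⇒≥ d≮) ≤e))))) (zeroʳ _)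

  solIsSubalgebra : SolIsSubalgebra
  solIsSubalgebra = record
    { sol-𝟙 = ((0 , λ { n (_ ∷ _) _ → refl }) , λ n w → substitute-𝟙 (killLast n) w) ,
              λ m i w → trans (substitute-𝟙 (mergeVar i) w) (sym (substitute-𝟙 (skipTwo i) w))
    ; sol-⊕ = λ { P Q (((d , Pd) , Pst) , Psol) (((e , Qe) , Qst) , Qsol) →
        ((d ℕ.+ e , λ n w de< → trans (+-cong (Pd n w (ℕ.≤-<-trans (ℕ.m≤m+n d e) de<))
                                              (Qe n w (ℕ.≤-<-trans (ℕ.m≤n+m e d) de<))) (+-identityˡ 0#)) ,
         λ n w → trans (substitute-⊕ (killLast n) P Q w) (+-cong (Pst n w) (Qst n w))) ,
        λ m i w → trans (substitute-⊕ (mergeVar i) P Q w)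
          (trans (+-cong (Psol m i w) (Qsol m i w)) (sym (substitute-⊕ (skipTwo i) P Q w))) }
    ; sol-• = λ { a P (((d , Pd) , Pst) , Psol) →
        ((d , λ n w d< → trans (*-congˡ (Pd n w d<)) (zeroʳ a)) ,
         λ n w → trans (substitute-• (killLast n) a P w) (*-congˡ (Pst n w))) ,
        λ m i w → trans (substitute-• (mergeVar i) a P w)
          (trans (*-congˡ (Psol m i w)) (sym (substitute-• (skipTwo i) a P w))) }
    ; sol-⊛ = λ { P Q ((Pd , Pst) , Psol) ((Qe , Qst) , Qsol) →
        (⊛-boundedDegree P Q Pd Qe ,
         λ n w → trans (substitute-⊛ (killLast n) P Q w)
           (∑-cong (splits w) (λ {s} _ → *-cong (Pst n (proj₁ s)) (Qst n (proj₂ s))))) ,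
        λ m i w → trans (substitute-⊛ (mergeVar i) P Q w)
          (trans (∑-cong (splits w) (λ {s} _ → *-cong (Psol m i (proj₁ s)) (Qsol m i (proj₂ s))))
                 (sym (substitute-⊛ (skipTwo i) P Q w))) }
    }

-- Words as lists of blocks of positions

∈-choices⁻ : ∀ (g : A → List B) {y} w {v} → v ∈ choices g (y ∷ w) →
             ∃ λ x → ∃ λ u → x ∈ g y × u ∈ choices g w × v ≡ x ∷ u
∈-choices⁻ g {y} w v∈ =
  let x , x∈ , v∈′ = find (∈-concatMap⁻ _ {xs = g y} v∈)
      u , u∈ , eq  = ∈-map⁻ (x ∷_) v∈′
  in x , u , x∈ , u∈ , eq

length-choices : ∀ (g : A → List B) w {v} → v ∈ choices g w → length v ≡ length w
length-choices g []      (here ≡.refl) = ≡.refl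
length-choices g (y ∷ w) v∈ with _ , u , _ , u∈ , ≡.refl ← ∈-choices⁻ g w v∈ = cong suc (length-choices g w u∈)

-- The alternative expected by `block-cong`: redistributing between `i` and `suc i` leaves the
-- positions of a third letter `j` alone.
∈-merge : ∀ i {x y j} → j ≢ i → j ≢ suc i → x ∈ merge i y → x ≡ y ⊎ (x ≢ j × y ≢ j)
∈-merge i {x} {y} j≢i j≢si x∈ with y ℕ.≟ i | y ℕ.≟ suc i
... | yes ≡.refl | _ with subst (x ∈_) (merge-first i) x∈
...   | here ≡.refl         = inj₁ ≡.refl
...   | there (here ≡.refl) = inj₂ (j≢si ∘ ≡.sym , j≢i ∘ ≡.sym)
∈-merge i {x} {y} j≢i j≢si x∈ | no _ | yes ≡.refl = case subst (x ∈_) (merge-second i) x∈ of λ ()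
∈-merge i {x} {y} j≢i j≢si x∈ | no y≢i | no y≢si with here eq ← subst (x ∈_) (merge-other i y≢i y≢si) x∈ = inj₁ eq

-- The positions of i in w, a position being the length of the suffix that
-- follows it.
block : ℕ → List ℕ → List ℕ
block i []      = []
block i (x ∷ w) with x ℕ.≟ i
... | yes _ = length w ∷ block i w
... | no  _ = block i w

block-self : ∀ i w → block i (i ∷ w) ≡ length w ∷ block i w
block-self i w with i ℕ.≟ i
... | yes _  = ≡.refl
... | no i≢i = contradiction ≡.refl i≢i

block-other : ∀ {i x} → x ≢ i → ∀ w → block i (x ∷ w) ≡ block i w
block-other {i} {x} x≢i w with x ℕ.≟ i
... | yes x≡i = contradiction x≡i x≢i
... | no _    = ≡.refl

block-∉ : ∀ {i} w → i ∉ w → block i w ≡ []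
block-∉ []      _   = ≡.refl
block-∉ (x ∷ w) i∉ = ≡.trans (block-other (i∉ ∘ here ∘ ≡.sym) w) (block-∉ w (i∉ ∘ there))

block-∈ : ∀ {i} w → i ∈ w → ∃ λ b → ∃ λ bs → block i w ≡ b ∷ bs
block-∈ {i} (x ∷ w) i∈ with x ℕ.≟ i | i∈
... | yes _  | _          = _ , _ , ≡.refl
... | no x≢i | here i≡x   = contradiction (≡.sym i≡x) x≢i
... | no _   | there i∈w = block-∈ w i∈w

block-< : ∀ i w {p} → p ∈ block i w → p < length w
block-< i (x ∷ w) p∈ with x ℕ.≟ i | p∈
... | yes _ | here ≡.refl = ℕ.≤-refl
... | yes _ | there p∈′   = ℕ.m≤n⇒m≤1+n (block-< i w p∈′)
... | no _  | p∈′         = ℕ.m≤n⇒m≤1+n (block-< i w p∈′)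

block-map : ∀ {φ : ℕ → ℕ} → (∀ {x y} → φ x ≡ φ y → x ≡ y) →
            ∀ i w → block (φ i) (map φ w) ≡ block i w
block-map φ-inj i [] = ≡.refl
block-map {φ} φ-inj i (x ∷ w) with x ℕ.≟ i
... | yes ≡.refl = ≡.trans (block-self (φ x) (map φ w)) (cong₂ _∷_ (List.length-map φ w) (block-map φ-inj i w))
... | no x≢i     = ≡.trans (block-other (x≢i ∘ φ-inj) (map φ w)) (block-map φ-inj i w)

block-cong : ∀ {j x y v w} → x ≡ y ⊎ (x ≢ j × y ≢ j) → length v ≡ length w →
             block j v ≡ block j w → block j (x ∷ v) ≡ block j (y ∷ w)
block-cong {j} {x} (inj₁ ≡.refl) len eq with x ℕ.≟ j
... | yes _ = cong₂ _∷_ len eq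
... | no _  = eq
block-cong {v = v} {w} (inj₂ (x≢j , y≢j)) len eq =
  ≡.trans (block-other x≢j v) (≡.trans eq (≡.sym (block-other y≢j w)))

block-choices-merge : ∀ i {j} → j ≢ i → j ≢ suc i → ∀ w {v} → v ∈ choices (merge i) w → block j v ≡ block j w
block-choices-merge i j≢i j≢si []      (here ≡.refl) = ≡.refl
block-choices-merge i j≢i j≢si (y ∷ w) v∈ with _ , u , x∈ , u∈ , ≡.refl ← ∈-choices⁻ (merge i) w v∈ =
  block-cong (∈-merge i j≢i j≢si x∈) (length-choices (merge i) w u∈) (block-choices-merge i j≢i j≢si w u∈)

-- Redistributing one block between two letters

bipartitions : List A → List (List A × List A)
bipartitions []      = ([] , []) ∷ []
bipartitions (x ∷ S) = map (λ (T , U) → x ∷ T , U) (bipartitions S) ++ map (λ (T , U) → T , x ∷ U) (bipartitions S)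

-- An equality of lists, not just a bijection, because `bipartitions` tries the two sides in the
-- order in which `merge` lists the two letters. If `suc i` occurred, there would be no choices at
-- all.
blocks-choices-merge : ∀ i w → suc i ∉ w →
  map (λ v → block i v , block (suc i) v) (choices (merge i) w) ≡ bipartitions (block i w)
blocks-choices-merge i []      _   = ≡.refl
blocks-choices-merge i (y ∷ w) si∉ with y ℕ.≟ i
... | no y≢i = begin
  map pair (concatMap (λ x → map (x ∷_) cs) (merge i y))
    ≡⟨ cong (map pair ∘ concatMap (λ x → map (x ∷_) cs)) (merge-other i y≢i y≢si) ⟩
  map pair (map (y ∷_) cs ++ [])  ≡⟨ cong (map pair) (List.++-identityʳ (map (y ∷_) cs)) ⟩
  map pair (map (y ∷_) cs)        ≡⟨ List.map-∘ cs ⟨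
  map (λ v → pair (y ∷ v)) cs     ≡⟨ List.map-cong (λ v → cong₂ _,_ (block-other y≢i v) (block-other y≢si v)) cs ⟩
  map pair cs                     ≡⟨ blocks-choices-merge i w (si∉ ∘ there) ⟩
  bipartitions (block i w)        ∎
  where
  open ≡-Reasoning
  pair = λ v → block i v , block (suc i) v
  cs = choices (merge i) w
  y≢si : y ≢ suc i
  y≢si = si∉ ∘ here ∘ ≡.sym
... | yes ≡.refl = begin
  map pair (concatMap (λ x → map (x ∷_) cs) (merge i i))
    ≡⟨ cong (map pair ∘ concatMap (λ x → map (x ∷_) cs)) (merge-first i) ⟩
  map pair (map (i ∷_) cs ++ map (suc i ∷_) cs ++ [])
    ≡⟨ cong (λ us → map pair (map (i ∷_) cs ++ us)) (List.++-identityʳ (map (suc i ∷_) cs)) ⟩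
  map pair (map (i ∷_) cs ++ map (suc i ∷_) cs)
    ≡⟨ List.map-++ pair (map (i ∷_) cs) (map (suc i ∷_) cs) ⟩
  map pair (map (i ∷_) cs) ++ map pair (map (suc i ∷_) cs)
    ≡⟨ cong₂ _++_ (side inFirst) (side inSecond) ⟩
  map (λ (T , U) → length w ∷ T , U) (map pair cs) ++ map (λ (T , U) → T , length w ∷ U) (map pair cs)
    ≡⟨ cong (λ ps → map (λ (T , U) → length w ∷ T , U) ps ++ map (λ (T , U) → T , length w ∷ U) ps)
         (blocks-choices-merge i w (si∉ ∘ there)) ⟩
  bipartitions (length w ∷ block i w) ∎
  where
  open ≡-Reasoning
  pair = λ v → block i v , block (suc i) v
  cs = choices (merge i) w
  inFirst : ∀ {v} → v ∈ cs → pair (i ∷ v) ≡ (length w ∷ block i v , block (suc i) v)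
  inFirst {v} v∈ = cong₂ _,_ (≡.trans (block-self i v) (cong (_∷ _) (length-choices (merge i) w v∈)))
                             (block-other (ℕ.1+n≢n ∘ ≡.sym) v)
  inSecond : ∀ {v} → v ∈ cs → pair (suc i ∷ v) ≡ (block i v , length w ∷ block (suc i) v)
  inSecond {v} v∈ = cong₂ _,_ (block-other ℕ.1+n≢n v)
                              (≡.trans (block-self (suc i) v) (cong (_∷ _) (length-choices (merge i) w v∈)))
  side : ∀ {x} {h : List ℕ × List ℕ → List ℕ × List ℕ} → (∀ {v} → v ∈ cs → pair (x ∷ v) ≡ h (pair v)) →
         map pair (map (x ∷_) cs) ≡ map h (map pair cs)
  side eq = ≡.trans (≡.sym (List.map-∘ cs)) (≡.trans (List.map-cong-local (All.tabulate eq)) (List.map-∘ cs))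

-- Lists of blocks and the words they encode

applyUpTo-cong : ∀ {f g : ℕ → A} → (∀ j → f j ≡ g j) → ∀ n → applyUpTo f n ≡ applyUpTo g n
applyUpTo-cong {f = f} {g} eq n =
  ≡.trans (≡.sym (List.map-upTo f n)) (≡.trans (List.map-cong eq (upTo n)) (List.map-upTo g n))

applyUpTo-+ : ∀ (f : ℕ → A) i k → applyUpTo f (i ℕ.+ k) ≡ applyUpTo f i ++ applyUpTo (λ j → f (i ℕ.+ j)) k
applyUpTo-+ f zero    k = ≡.refl
applyUpTo-+ f (suc i) k = cong (f 0 ∷_) (applyUpTo-+ (f ∘ suc) i k)

applyUpTo-skip₂ : ∀ (f : ℕ → A) i k → applyUpTo f (suc (suc (i ℕ.+ k))) ≡
  applyUpTo (f ∘ skip₂ i) i ++ f i ∷ f (suc i) ∷ applyUpTo (λ j → f (skip₂ i (i ℕ.+ j))) k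
applyUpTo-skip₂ f zero    k = ≡.refl
applyUpTo-skip₂ f (suc i) k = cong (f 0 ∷_) (applyUpTo-skip₂ (f ∘ suc) i k)

blockIndex : ℕ → List (List ℕ) → ℕ
blockIndex p []       = 0
blockIndex p (B ∷ Bs) = if does (p ∈? B) then 0 else suc (blockIndex p Bs)

blockIndex-empty : ∀ p Bs Cs → blockIndex p (Bs ++ [] ∷ Cs) ≡ skip (length Bs) (blockIndex p (Bs ++ Cs))
blockIndex-empty p []       Cs = ≡.refl
blockIndex-empty p (B ∷ Bs) Cs with does (p ∈? B)
... | true  = ≡.refl
... | false = cong suc (blockIndex-empty p Bs Cs)

blockIndex-applyUpTo : ∀ {p} (f : ℕ → List ℕ) {n x} → x < n → p ∈ f x → (∀ {j} → j ≢ x → p ∉ f j) →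
                       blockIndex p (applyUpTo f n) ≡ x
blockIndex-applyUpTo {p} f {suc n} {zero}  _         p∈ p∉ rewrite dec-true (p ∈? f 0) p∈ = ≡.refl
blockIndex-applyUpTo {p} f {suc n} {suc x} (s≤s x<n) p∈ p∉ rewrite dec-false (p ∈? f 0) (p∉ λ ()) =
  cong suc (blockIndex-applyUpTo (f ∘ suc) x<n p∈ (λ j≢x → p∉ (j≢x ∘ ℕ.suc-injective)))

blockIndex-cong : ∀ {p} {f g : ℕ → List ℕ} → (∀ j → p ∈ f j ⇔ p ∈ g j) → ∀ n →
                  blockIndex p (applyUpTo f n) ≡ blockIndex p (applyUpTo g n)
blockIndex-cong eq zero = ≡.refl
blockIndex-cong {p} {f} {g} eq (suc n) rewrite does-⇔ (eq 0) (p ∈? f 0) (p ∈? g 0) with does (p ∈? g 0)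
... | true  = ≡.refl
... | false = cong suc (blockIndex-cong (eq ∘ suc) n)

-- The positions run downwards because they are counted from the end of the word.
fromBlocks : ℕ → List (List ℕ) → List ℕ
fromBlocks l Bs = map (λ p → blockIndex p Bs) (downFrom l)

fromBlocks-empty : ∀ l Bs Cs → fromBlocks l (Bs ++ [] ∷ Cs) ≡ map (skip (length Bs)) (fromBlocks l (Bs ++ Cs))
fromBlocks-empty l Bs Cs =
  ≡.trans (List.map-cong (λ p → blockIndex-empty p Bs Cs) (downFrom l)) (List.map-∘ (downFrom l))

length-fromBlocks : ∀ l Bs → length (fromBlocks l Bs) ≡ l
length-fromBlocks l Bs = ≡.trans (List.length-map _ (downFrom l)) (List.length-downFrom l)

fromBlocks-blocks : ∀ {n} w → (∀ {x} → x ∈ w → x < n) → fromBlocks (length w) (applyUpTo (λ j → block j w) n) ≡ w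
fromBlocks-blocks []      _   = ≡.refl
fromBlocks-blocks {n} (x ∷ w) w<n = cong₂ _∷_
  (blockIndex-applyUpTo (λ j → block j (x ∷ w)) (w<n (here ≡.refl))
    (subst (length w ∈_) (≡.sym (block-self x w)) (here ≡.refl))
    (λ {j} j≢x p∈ → ℕ.<-irrefl ≡.refl (block-< j w (subst (length w ∈_) (block-other (j≢x ∘ ≡.sym) w) p∈))))
  (≡.trans
    (List.map-cong-local (All.tabulate λ {p} p∈ → blockIndex-cong (sameTail (∈-downFrom⁻ p∈)) n))
    (fromBlocks-blocks w (w<n ∘ there)))
  where
  sameTail : ∀ {p} → p < length w → ∀ j → p ∈ block j (x ∷ w) ⇔ p ∈ block j w
  sameTail p<l j with x ℕ.≟ j
  ... | no _  = mk⇔ id id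
  ... | yes _ = mk⇔ (λ { (here ≡.refl) → contradiction p<l (ℕ.<-irrefl ≡.refl) ; (there p∈) → p∈ }) there

-- Evaluation at the alternating alphabet

module Alternation (K : CommutativeRing 0ℓ 0ℓ) where
  open Sums K

  private variable
    X : Set

  -- A signed family of block lists is represented by what it does to a functional; inductions on a
  -- set of positions then proceed by changing the functional.
  Functional : Set → Set
  Functional X = List (List X) → Carrier

  -- Skip invariance, in the language of blocks.
  EmptyInvariant : Functional X → Set
  EmptyInvariant k = ∀ Bs Cs → k (Bs ++ [] ∷ Cs) ≈ k (Bs ++ Cs)

  emptyInvariant-++ : ∀ {k : Functional X} → EmptyInvariant k → ∀ Ds → EmptyInvariant (λ Bs → k (Bs ++ Ds))
  emptyInvariant-++ {k = k} k-inv Ds Bs Cs = begin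
    k ((Bs ++ [] ∷ Cs) ++ Ds)  ≡⟨ cong k (List.++-assoc Bs ([] ∷ Cs) Ds) ⟩
    k (Bs ++ [] ∷ Cs ++ Ds)    ≈⟨ k-inv Bs (Cs ++ Ds) ⟩
    k (Bs ++ Cs ++ Ds)         ≡⟨ cong k (List.++-assoc Bs Cs Ds) ⟨
    k ((Bs ++ Cs) ++ Ds)       ∎

  emptyInvariant-prefix : ∀ {k : Functional X} → EmptyInvariant k → ∀ Ds → EmptyInvariant (λ Bs → k (Ds ++ Bs))
  emptyInvariant-prefix {k = k} k-inv Ds Bs Cs = begin
    k (Ds ++ Bs ++ [] ∷ Cs)    ≡⟨ cong k (List.++-assoc Ds Bs ([] ∷ Cs)) ⟨
    k ((Ds ++ Bs) ++ [] ∷ Cs)  ≈⟨ k-inv (Ds ++ Bs) Cs ⟩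
    k ((Ds ++ Bs) ++ Cs)       ≡⟨ cong k (List.++-assoc Ds Bs Cs) ⟩
    k (Ds ++ Bs ++ Cs)         ∎

  -- The sum of k over all ways of adding x to an ordered list of blocks: with
  -- sign + when x joins a block, with sign − when x forms a new block.
  insert : X → Functional X → Functional X
  insert x k []       = - k ((x ∷ []) ∷ [])
  insert x k (B ∷ Bs) = (k ((x ∷ B) ∷ Bs) + - k ((x ∷ []) ∷ B ∷ Bs)) + insert x (k ∘ (B ∷_)) Bs

  insert-cong : ∀ (x : X) {k l} → (∀ Bs → k Bs ≈ l Bs) → ∀ Bs → insert x k Bs ≈ insert x l Bs
  insert-cong x eq []       = -‿cong (eq _)
  insert-cong x eq (B ∷ Bs) = +-cong (+-cong (eq _) (-‿cong (eq _))) (insert-cong x (eq ∘ (B ∷_)) Bs)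

  insert-+ : ∀ (x : X) k l Bs → insert x (λ Cs → k Cs + l Cs) Bs ≈ insert x k Bs + insert x l Bs
  insert-+ x k l []       = sym (-‿+-comm _ _)
  insert-+ x k l (B ∷ Bs) = begin
    ((k _ + l _) + - (k _ + l _)) + insert x (λ Cs → k (B ∷ Cs) + l (B ∷ Cs)) Bs
      ≈⟨ +-cong (+-congˡ (sym (-‿+-comm _ _))) (insert-+ x (k ∘ (B ∷_)) (l ∘ (B ∷_)) Bs) ⟩
    ((k _ + l _) + (- k _ + - l _)) + (insert x (k ∘ (B ∷_)) Bs + insert x (l ∘ (B ∷_)) Bs)
      ≈⟨ +-congʳ (interchange _ _ _ _) ⟩
    ((k _ + - k _) + (l _ + - l _)) + (insert x (k ∘ (B ∷_)) Bs + insert x (l ∘ (B ∷_)) Bs)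
      ≈⟨ interchange _ _ _ _ ⟩
    insert x k (B ∷ Bs) + insert x l (B ∷ Bs) ∎

  insert-0 : ∀ (x : X) Bs → insert x (λ _ → 0#) Bs ≈ 0#
  insert-0 x []       = -0#≈0#
  insert-0 x (B ∷ Bs) = trans (+-cong (-‿inverseʳ 0#) (insert-0 x Bs)) (+-identityˡ 0#)

  -- An empty block offers `x` one more block to join and one more place for a new block. Both
  -- amount to a new block at the same place, with opposite signs.
  insert-emptyInvariant : ∀ (x : X) {k} → EmptyInvariant k → EmptyInvariant (insert x k)
  insert-emptyInvariant x {k} k-inv [] Cs = begin
    (k ((x ∷ []) ∷ Cs) + - k ((x ∷ []) ∷ [] ∷ Cs)) + insert x (k ∘ ([] ∷_)) Cs
      ≈⟨ +-cong (+-congˡ (-‿cong (k-inv ((x ∷ []) ∷ []) Cs))) (insert-cong x (k-inv []) Cs) ⟩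
    (k ((x ∷ []) ∷ Cs) + - k ((x ∷ []) ∷ Cs)) + insert x k Cs
      ≈⟨ +-congʳ (-‿inverseʳ _) ⟩
    0# + insert x k Cs
      ≈⟨ +-identityˡ _ ⟩
    insert x k Cs ∎
  insert-emptyInvariant x {k} k-inv (B ∷ Bs) Cs = +-cong
    (+-cong (k-inv ((x ∷ B) ∷ Bs) Cs) (-‿cong (k-inv ((x ∷ []) ∷ B ∷ Bs) Cs)))
    (insert-emptyInvariant x (k-inv ∘ (B ∷_)) Bs Cs)

  -- The left side is every insertion into `B ∷ Bs` but one, the new block in front of `B`; it has
  -- sign -, hence the positive correction on the right.
  insert-∷ : ∀ (x : X) k B Bs →
    k ((x ∷ B) ∷ Bs) + insert x (k ∘ (B ∷_)) Bs ≈ insert x k (B ∷ Bs) + k ((x ∷ []) ∷ B ∷ Bs)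
  insert-∷ x k B Bs = begin
    a + c                ≈⟨ +-identityʳ _ ⟨
    (a + c) + 0#         ≈⟨ +-congˡ (-‿inverseˡ b) ⟨
    (a + c) + (- b + b)  ≈⟨ +-assoc _ _ _ ⟨
    ((a + c) + - b) + b  ≈⟨ +-congʳ (trans (+-assoc _ _ _) (trans (+-congˡ (+-comm _ _)) (sym (+-assoc _ _ _)))) ⟩
    ((a + - b) + c) + b  ∎
    where
    a = k ((x ∷ B) ∷ Bs)
    b = k ((x ∷ []) ∷ B ∷ Bs)
    c = insert x (k ∘ (B ∷_)) Bs

  -- Here the missing insertion is the new block after the last one.
  insert-∷ʳ : ∀ (x : X) k Bs C →
    insert x (λ Ds → k (Ds ++ C ∷ [])) Bs + k (Bs ++ (x ∷ C) ∷ []) ≈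
    insert x k (Bs ++ C ∷ []) + k (Bs ++ C ∷ (x ∷ []) ∷ [])
  insert-∷ʳ x k [] C = begin
    - a + b                ≈⟨ +-comm _ _ ⟩
    b + - a                ≈⟨ +-identityʳ _ ⟨
    (b + - a) + 0#         ≈⟨ +-congˡ (-‿inverseˡ c) ⟨
    (b + - a) + (- c + c)  ≈⟨ +-assoc _ _ _ ⟨
    ((b + - a) + - c) + c  ∎
    where
    a = k ((x ∷ []) ∷ C ∷ [])
    b = k ((x ∷ C) ∷ [])
    c = k (C ∷ (x ∷ []) ∷ [])
  insert-∷ʳ x k (B ∷ Bs) C =
    trans (+-assoc _ _ _) (trans (+-congˡ (insert-∷ʳ x (k ∘ (B ∷_)) Bs C)) (sym (+-assoc _ _ _)))

  -- ∑ (-1)^r k (B₁ ∷ … ∷ B_r ∷ []) over the ordered set partitions of S: the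
  -- value of k at the ordinal opposite of a single variable.
  opposite : List X → Functional X → Carrier
  opposite []      k = k []
  opposite (x ∷ S) k = opposite S (insert x k)

  opposite-cong : ∀ (S : List X) {k l} → (∀ Bs → k Bs ≈ l Bs) → opposite S k ≈ opposite S l
  opposite-cong []      eq = eq []
  opposite-cong (x ∷ S) eq = opposite-cong S (insert-cong x eq)

  opposite-+ : ∀ (S : List X) k l → opposite S (λ Bs → k Bs + l Bs) ≈ opposite S k + opposite S l
  opposite-+ []      k l = refl
  opposite-+ (x ∷ S) k l = trans (opposite-cong S (insert-+ x k l)) (opposite-+ S (insert x k) (insert x l))

  opposite-0 : ∀ (S : List X) → opposite S (λ _ → 0#) ≈ 0#
  opposite-0 []      = refl
  opposite-0 (x ∷ S) = trans (opposite-cong S (insert-0 x)) (opposite-0 S)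

  opposite-∑ : ∀ {P : Set} (S : List X) (ps : List P) (k : P → Functional X) →
               opposite S (λ Bs → ∑ ps (λ p → k p Bs)) ≈ ∑ ps (λ p → opposite S (k p))
  opposite-∑ S []       k = opposite-0 S
  opposite-∑ S (p ∷ ps) k =
    trans (opposite-+ S (k p) (λ Bs → ∑ ps (λ q → k q Bs))) (+-congˡ (opposite-∑ S ps k))

  -- The counit, that is, the unit of the convolution.
  ifEmpty : List X → Carrier → Carrier
  ifEmpty []      a = a
  ifEmpty (_ ∷ _) a = 0#

  ifEmpty-cancel : ∀ (S : List X) a → ifEmpty S (- a) + ifEmpty S a ≈ 0#
  ifEmpty-cancel []      a = -‿inverseˡ a
  ifEmpty-cancel (_ ∷ _) a = +-identityˡ 0#

  opposite-ifEmpty : ∀ (S : List X) (T : List X) k → opposite S (λ Bs → ifEmpty T (k Bs)) ≈ ifEmpty T (opposite S k)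
  opposite-ifEmpty S []      k = refl
  opposite-ifEmpty S (_ ∷ _) k = opposite-0 S

  ∑-opposite-+ : ∀ {P : Set} (ps : List P) (S : P → List X) (k l : P → Functional X) →
    ∑ ps (λ p → opposite (S p) (k p)) + ∑ ps (λ p → opposite (S p) (l p)) ≈
    ∑ ps (λ p → opposite (S p) (λ Bs → k p Bs + l p Bs))
  ∑-opposite-+ ps S k l =
    trans (sym (∑-distrib-+ ps _ _)) (∑-cong ps (λ {p} _ → sym (opposite-+ (S p) (k p) (l p))))

  ∑-bipartitions-∷ : ∀ (x : X) S (f : List X → List X → Carrier) →
    ∑ (bipartitions (x ∷ S)) (λ (T , U) → f T U) ≈
    ∑ (bipartitions S) (λ (T , U) → f (x ∷ T) U) + ∑ (bipartitions S) (λ (T , U) → f T (x ∷ U))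
  ∑-bipartitions-∷ x S f = trans (∑-++ (map _ (bipartitions S)) _ _)
    (+-cong (∑-map _ (bipartitions S) _) (∑-map _ (bipartitions S) _))

  -- The new element joins `T` or enters the opposite of `U`. By `insert-∷` the two cases together
  -- give the same sum over `S` for the functional `insert x k` and for `k` with the block of `x`
  -- alone in front. By induction both sums live on empty `S`, where they are opposite.
  opposite-inverseʳ : ∀ (S : List X) {k} → EmptyInvariant k →
    ∑ (bipartitions S) (λ (T , U) → opposite U (λ Bs → k (T ∷ Bs))) ≈ ifEmpty S (k [])
  opposite-inverseʳ []      {k} k-inv = trans (+-identityʳ _) (k-inv [] [])
  opposite-inverseʳ (x ∷ S) {k} k-inv = begin
    ∑ (bipartitions (x ∷ S)) (λ (T , U) → opposite U (λ Bs → k (T ∷ Bs)))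
      ≈⟨ ∑-bipartitions-∷ x S (λ T U → opposite U (λ Bs → k (T ∷ Bs))) ⟩
    _ ≈⟨ ∑-opposite-+ (bipartitions S) proj₂ (λ p Bs → k ((x ∷ proj₁ p) ∷ Bs))
           (λ p → insert x (λ Bs → k (proj₁ p ∷ Bs))) ⟩
    _ ≈⟨ ∑-cong (bipartitions S) (λ {p} _ → opposite-cong (proj₂ p) (insert-∷ x k (proj₁ p))) ⟩
    _ ≈⟨ ∑-opposite-+ (bipartitions S) proj₂ (λ p Bs → insert x k (proj₁ p ∷ Bs))
           (λ p Bs → k ((x ∷ []) ∷ proj₁ p ∷ Bs)) ⟨
    _ ≈⟨ +-cong (opposite-inverseʳ S {insert x k} (insert-emptyInvariant x k-inv))
                (opposite-inverseʳ S {k ∘ ((x ∷ []) ∷_)} (k-inv ∘ ((x ∷ []) ∷_))) ⟩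
    ifEmpty S (insert x k []) + ifEmpty S (k ((x ∷ []) ∷ []))
      ≈⟨ ifEmpty-cancel S _ ⟩
    0# ∎

  -- The mirror image: the block of `x` alone is now put at the end.
  opposite-inverseˡ : ∀ (S : List X) {k} → EmptyInvariant k →
    ∑ (bipartitions S) (λ (T , U) → opposite T (λ Bs → k (Bs ++ U ∷ []))) ≈ ifEmpty S (k [])
  opposite-inverseˡ []      {k} k-inv = trans (+-identityʳ _) (k-inv [] [])
  opposite-inverseˡ (x ∷ S) {k} k-inv = begin
    ∑ (bipartitions (x ∷ S)) (λ (T , U) → opposite T (λ Bs → k (Bs ++ U ∷ [])))
      ≈⟨ ∑-bipartitions-∷ x S (λ T U → opposite T (λ Bs → k (Bs ++ U ∷ []))) ⟩
    _ ≈⟨ ∑-opposite-+ (bipartitions S) proj₁ (λ p → insert x (λ Bs → k (Bs ++ proj₂ p ∷ [])))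
           (λ p Bs → k (Bs ++ (x ∷ proj₂ p) ∷ [])) ⟩
    _ ≈⟨ ∑-cong (bipartitions S) (λ {p} _ → opposite-cong (proj₁ p) (λ Bs → trans (insert-∷ʳ x k Bs (proj₂ p))
           (+-congˡ (reflexive (cong k (≡.sym (List.++-assoc Bs (proj₂ p ∷ []) ((x ∷ []) ∷ [])))))))) ⟩
    _ ≈⟨ ∑-opposite-+ (bipartitions S) proj₁ (λ p Bs → insert x k (Bs ++ proj₂ p ∷ []))
           (λ p Bs → k ((Bs ++ proj₂ p ∷ []) ++ (x ∷ []) ∷ [])) ⟨
    _ ≈⟨ +-cong (opposite-inverseˡ S {insert x k} (insert-emptyInvariant x k-inv))
                (opposite-inverseˡ S {λ Bs → k (Bs ++ (x ∷ []) ∷ [])}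
                  (emptyInvariant-++ {k = k} k-inv ((x ∷ []) ∷ []))) ⟩
    ifEmpty S (insert x k []) + ifEmpty S (k ((x ∷ []) ∷ []))
      ≈⟨ ifEmpty-cancel S _ ⟩
    0# ∎

  -- Evaluation at the alternating alphabet a₁ ⊖ a₂ ⊕ a₃ ⊖ ⋯ of a list of blocks,
  -- the first block being that of a variable of sign + (resp. −).
  alternate⁺ alternate⁻ : List (List X) → Functional X → Carrier
  alternate⁺ []       k = k []
  alternate⁺ (B ∷ Bs) k = alternate⁻ Bs (λ Cs → k (B ∷ Cs))
  alternate⁻ []       k = k []
  alternate⁻ (B ∷ Bs) k = opposite B (λ Cs → alternate⁺ Bs (λ Ds → k (Cs ++ Ds)))

  alternate⁺-cong : ∀ (Bs : List (List X)) {k l} → (∀ Cs → k Cs ≈ l Cs) → alternate⁺ Bs k ≈ alternate⁺ Bs l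
  alternate⁻-cong : ∀ (Bs : List (List X)) {k l} → (∀ Cs → k Cs ≈ l Cs) → alternate⁻ Bs k ≈ alternate⁻ Bs l
  alternate⁺-cong []       eq = eq []
  alternate⁺-cong (B ∷ Bs) eq = alternate⁻-cong Bs (eq ∘ (B ∷_))
  alternate⁻-cong []       eq = eq []
  alternate⁻-cong (B ∷ Bs) eq = opposite-cong B (λ Cs → alternate⁺-cong Bs (eq ∘ (Cs ++_)))

  alternate⁺-0 : ∀ (Bs : List (List X)) → alternate⁺ Bs (λ _ → 0#) ≈ 0#
  alternate⁻-0 : ∀ (Bs : List (List X)) → alternate⁻ Bs (λ _ → 0#) ≈ 0#
  alternate⁺-0 []       = refl
  alternate⁺-0 (B ∷ Bs) = alternate⁻-0 Bs
  alternate⁻-0 []       = refl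
  alternate⁻-0 (B ∷ Bs) = trans (opposite-cong B (λ _ → alternate⁺-0 Bs)) (opposite-0 B)

  -- A last empty block of sign + is removed by invariance, and one of sign - contributes no block
  -- at all. This is stability.
  alternate⁺-∷ʳ-empty : ∀ (Bs : List (List X)) {k} → EmptyInvariant k →
                        alternate⁺ (Bs ++ [] ∷ []) k ≈ alternate⁺ Bs k
  alternate⁻-∷ʳ-empty : ∀ (Bs : List (List X)) {k} → EmptyInvariant k →
                        alternate⁻ (Bs ++ [] ∷ []) k ≈ alternate⁻ Bs k
  alternate⁺-∷ʳ-empty []       k-inv = k-inv [] []
  alternate⁺-∷ʳ-empty (B ∷ Bs) {k} k-inv = alternate⁻-∷ʳ-empty Bs {k ∘ (B ∷_)} (k-inv ∘ (B ∷_))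
  alternate⁻-∷ʳ-empty []       k-inv = refl
  alternate⁻-∷ʳ-empty (B ∷ Bs) {k} k-inv =
    opposite-cong B (λ Cs → alternate⁺-∷ʳ-empty Bs {k ∘ (Cs ++_)} (emptyInvariant-prefix {k = k} k-inv Cs))

  -- Removing two adjacent variables preserves the signs of all others, so `Bs` and `Cs` are
  -- passive. The sign in front of `T` decides which of the two inverse laws applies.
  alternate⁺-bipartitions : ∀ Bs Cs (S : List X) {k} → EmptyInvariant k →
    ∑ (bipartitions S) (λ (T , U) → alternate⁺ (Bs ++ T ∷ U ∷ Cs) k) ≈ ifEmpty S (alternate⁺ (Bs ++ Cs) k)
  alternate⁻-bipartitions : ∀ Bs Cs (S : List X) {k} → EmptyInvariant k →
    ∑ (bipartitions S) (λ (T , U) → alternate⁻ (Bs ++ T ∷ U ∷ Cs) k) ≈ ifEmpty S (alternate⁻ (Bs ++ Cs) k)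
  alternate⁺-bipartitions []       Cs S {k} k-inv =
    opposite-inverseʳ S {λ Ds → alternate⁺ Cs (λ Es → k (Ds ++ Es))}
      (λ Ds Es → alternate⁺-cong Cs (λ Fs → emptyInvariant-++ {k = k} k-inv Fs Ds Es))
  alternate⁺-bipartitions (B ∷ Bs) Cs S {k} k-inv = alternate⁻-bipartitions Bs Cs S {k ∘ (B ∷_)} (k-inv ∘ (B ∷_))
  alternate⁻-bipartitions []       Cs S {k} k-inv = begin
    ∑ (bipartitions S) (λ (T , U) → opposite T (λ Ds → alternate⁻ Cs (λ Es → k (Ds ++ U ∷ Es))))
      -- `U` belongs to a variable of sign + and must be the last block of its own list before the
      -- left inverse law applies.
      ≈⟨ ∑-cong (bipartitions S) (λ {p} _ → opposite-cong (proj₁ p) (λ Ds → alternate⁻-cong Cs (λ Es →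
           reflexive (cong k (≡.sym (List.++-assoc Ds (proj₂ p ∷ []) Es)))))) ⟩
    ∑ (bipartitions S) (λ (T , U) → opposite T (λ Ds → alternate⁻ Cs (λ Es → k ((Ds ++ U ∷ []) ++ Es))))
      ≈⟨ opposite-inverseˡ S {λ Ds → alternate⁻ Cs (λ Es → k (Ds ++ Es))}
           (λ Ds Es → alternate⁻-cong Cs (λ Fs → emptyInvariant-++ {k = k} k-inv Fs Ds Es)) ⟩
    ifEmpty S (alternate⁻ Cs k) ∎
  alternate⁻-bipartitions (B ∷ Bs) Cs S {k} k-inv = begin
    ∑ (bipartitions S) (λ (T , U) → opposite B (λ Ds → alternate⁺ (Bs ++ T ∷ U ∷ Cs) (λ Es → k (Ds ++ Es))))
      ≈⟨ opposite-∑ B (bipartitions S) (λ (T , U) Ds → alternate⁺ (Bs ++ T ∷ U ∷ Cs) (λ Es → k (Ds ++ Es))) ⟨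
    opposite B (λ Ds → ∑ (bipartitions S) (λ (T , U) → alternate⁺ (Bs ++ T ∷ U ∷ Cs) (λ Es → k (Ds ++ Es))))
      ≈⟨ opposite-cong B (λ Ds → alternate⁺-bipartitions Bs Cs S {k ∘ (Ds ++_)}
           (emptyInvariant-prefix {k = k} k-inv Ds)) ⟩
    opposite B (λ Ds → ifEmpty S (alternate⁺ (Bs ++ Cs) (λ Es → k (Ds ++ Es))))
      ≈⟨ opposite-ifEmpty B S _ ⟩
    ifEmpty S (alternate⁻ (B ∷ Bs ++ Cs) k) ∎

  -- The even letters have sign +, so their blocks stay whole; the empty blocks of sign - disappear.
  alternate⁺-even : ∀ (f : ℕ → List X) n k → (∀ j → f (suc (j ℕ.* 2)) ≡ []) →
                    alternate⁺ (applyUpTo f (n ℕ.* 2)) k ≈ k (applyUpTo (λ j → f (j ℕ.* 2)) n)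
  alternate⁺-even f zero    k eq = refl
  alternate⁺-even f (suc n) k eq rewrite eq 0 = alternate⁺-even (f ∘ suc ∘ suc) n (k ∘ (f 0 ∷_)) (eq ∘ suc)

-- The alternating evaluation solves the functional equation

toℕ∈-< : ∀ {n} (w : List (Fin n)) {x} → x ∈ map toℕ w → x < n
toℕ∈-< w x∈ with y , _ , ≡.refl ← ∈-map⁻ toℕ x∈ = Fin.toℕ<n y

module Evaluation (K : CommutativeRing 0ℓ 0ℓ) where
  open Solutions K public
  open Alternation K public

  SkipInvariant : (List ℕ → Carrier) → Set
  SkipInvariant S = ∀ i w → S (map (skip i) w) ≈ S w

  blocks : List ℕ → ℕ → List (List ℕ)
  blocks w n = applyUpTo (λ j → block j w) n

  evaluation : (List ℕ → Carrier) → ℕ → List ℕ → Carrier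
  evaluation S n w = alternate⁺ (blocks w n) (λ Bs → S (fromBlocks (length w) Bs))

  alternatingSeq : (List ℕ → Carrier) → Seq
  alternatingSeq S n w = evaluation S n (map toℕ w)

  module _ {S : List ℕ → Carrier} (S-skip : SkipInvariant S) where

    fromBlocks-emptyInvariant : ∀ l → EmptyInvariant (λ Bs → S (fromBlocks l Bs))
    fromBlocks-emptyInvariant l Bs Cs =
      trans (reflexive (cong S (fromBlocks-empty l Bs Cs))) (S-skip (length Bs) _)

    evaluation-suc : ∀ n w → (∀ {x} → x ∈ w → x < n) → evaluation S (suc n) w ≈ evaluation S n w
    evaluation-suc n w w<n = begin
      alternate⁺ (blocks w (suc n)) k
        ≡⟨ cong (λ Bs → alternate⁺ Bs k) (List.applyUpTo-∷ʳ (λ j → block j w) n) ⟨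
      alternate⁺ (blocks w n ++ block n w ∷ []) k
        ≡⟨ cong (λ B → alternate⁺ (blocks w n ++ B ∷ []) k) (block-∉ w (λ n∈ → ℕ.<-irrefl ≡.refl (w<n n∈))) ⟩
      alternate⁺ (blocks w n ++ [] ∷ []) k
        ≈⟨ alternate⁺-∷ʳ-empty (blocks w n) {k} (fromBlocks-emptyInvariant (length w)) ⟩
      alternate⁺ (blocks w n) k ∎
      where k = λ Bs → S (fromBlocks (length w) Bs)

    -- Writing the number of variables as `i + l` separates the letters before the merged pair from
    -- the `l` letters after it.
    evaluation-merge : ∀ i l w →
      ∑ (choices (merge i) w) (evaluation S (suc (suc (i ℕ.+ l)))) ≈ ∑ (choices (gap i) w) (evaluation S (i ℕ.+ l))
    evaluation-merge i l w with suc i ∈? w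
    -- Neither substitution reaches the letter `suc i`: both sums are empty.
    ... | yes si∈ = reflexive (≡.trans
      (cong (λ us → ∑ us (evaluation S (suc (suc (i ℕ.+ l))))) (choices-empty si∈ (merge-second i)))
      (≡.sym (cong (λ us → ∑ us (evaluation S (i ℕ.+ l))) (choices-empty si∈ (gap-second i)))))
    ... | no si∉ = begin
      ∑ cs (evaluation S (suc (suc (i ℕ.+ l))))
        ≈⟨ ∑-cong cs (λ {v} v∈ → reflexive (cong₂ (λ Bs m → alternate⁺ Bs (λ Cs → S (fromBlocks m Cs)))
             (split-blocks v∈) (length-choices (merge i) w v∈))) ⟩
      ∑ cs (λ v → alternate⁺ (before ++ block i v ∷ block (suc i) v ∷ after) k)
        ≈⟨ ∑-map (λ v → block i v , block (suc i) v) cs _ ⟨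
      ∑ (map (λ v → block i v , block (suc i) v) cs) (λ (T , U) → alternate⁺ (before ++ T ∷ U ∷ after) k)
        ≡⟨ cong (λ ps → ∑ ps (λ (T , U) → alternate⁺ (before ++ T ∷ U ∷ after) k)) (blocks-choices-merge i w si∉) ⟩
      ∑ (bipartitions (block i w)) (λ (T , U) → alternate⁺ (before ++ T ∷ U ∷ after) k)
        ≈⟨ alternate⁺-bipartitions before after (block i w) {k} (fromBlocks-emptyInvariant (length w)) ⟩
      ifEmpty (block i w) (alternate⁺ (before ++ after) k)
        ≈⟨ gapped ⟩
      ∑ (choices (gap i) w) (evaluation S (i ℕ.+ l)) ∎
      where
      cs     = choices (merge i) w
      k      = λ Bs → S (fromBlocks (length w) Bs)
      before = applyUpTo (λ j → block (skip₂ i j) w) i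
      after  = applyUpTo (λ j → block (skip₂ i (i ℕ.+ j)) w) l

      split-blocks : ∀ {v} → v ∈ cs →
                     blocks v (suc (suc (i ℕ.+ l))) ≡ before ++ block i v ∷ block (suc i) v ∷ after
      split-blocks {v} v∈ = ≡.trans (applyUpTo-skip₂ (λ j → block j v) i l)
        (cong₂ (λ Bs Cs → Bs ++ block i v ∷ block (suc i) v ∷ Cs)
          (applyUpTo-cong same i) (applyUpTo-cong (λ j → same (i ℕ.+ j)) l))
        where
        same : ∀ j → block (skip₂ i j) v ≡ block (skip₂ i j) w
        same j = block-choices-merge i (skip₂≢first i j) (skip₂≢second i j) w v∈

      gapped : ifEmpty (block i w) (alternate⁺ (before ++ after) k) ≈ ∑ (choices (gap i) w) (evaluation S (i ℕ.+ l))
      gapped with i ∈? w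
      -- The block of `i` is nonempty, so the counit vanishes, as does the sum over `gap`.
      ... | yes i∈ with _ , _ , eq ← block-∈ w i∈ = begin
        ifEmpty (block i w) (alternate⁺ (before ++ after) k)
          ≡⟨ cong (λ B → ifEmpty B (alternate⁺ (before ++ after) k)) eq ⟩
        0#
          ≡⟨ cong (λ us → ∑ us (evaluation S (i ℕ.+ l))) (choices-empty i∈ (gap-first i)) ⟨
        ∑ (choices (gap i) w) (evaluation S (i ℕ.+ l)) ∎
      ... | no i∉ with v , eq ← unskip₂-map i w i∉ si∉ = begin
        ifEmpty (block i w) (alternate⁺ (before ++ after) k)
          ≡⟨ cong (λ B → ifEmpty B (alternate⁺ (before ++ after) k)) (block-∉ w i∉) ⟩
        alternate⁺ (before ++ after) k
          ≡⟨ cong₂ (λ Bs m → alternate⁺ Bs (λ Cs → S (fromBlocks m Cs))) joined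
               (≡.trans (cong length (≡.sym eq)) (List.length-map (skip₂ i) v)) ⟩
        evaluation S (i ℕ.+ l) v
          ≈⟨ +-identityʳ _ ⟨
        ∑ (v ∷ []) (evaluation S (i ℕ.+ l))
          ≡⟨ cong (λ us → ∑ us (evaluation S (i ℕ.+ l)))
               (≡.trans (cong (choices (gap i)) (≡.sym eq)) (choices-gap-skip₂ i v)) ⟨
        ∑ (choices (gap i) w) (evaluation S (i ℕ.+ l)) ∎
        where
        joined : before ++ after ≡ blocks v (i ℕ.+ l)
        joined = ≡.trans (≡.sym (applyUpTo-+ (λ j → block (skip₂ i j) w) i l))
          (applyUpTo-cong (λ j → ≡.trans (cong (block (skip₂ i j)) (≡.sym eq))
            (block-map (skip₂-injective i) j v)) (i ℕ.+ l))

    evaluation-even : ∀ n w → (∀ {x} → x ∈ w → x < n) → evaluation S (n ℕ.* 2) (map (ℕ._* 2) w) ≈ S w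
    evaluation-even n w w<n = begin
      evaluation S (n ℕ.* 2) (map (ℕ._* 2) w)
        ≈⟨ alternate⁺-even (λ j → block j (map (ℕ._* 2) w)) n _ (λ j → block-∉ (map (ℕ._* 2) w) (odd∉ j)) ⟩
      S (fromBlocks (length (map (ℕ._* 2) w)) (applyUpTo (λ j → block (j ℕ.* 2) (map (ℕ._* 2) w)) n))
        ≡⟨ cong₂ (λ m Bs → S (fromBlocks m Bs)) (List.length-map (ℕ._* 2) w)
             (applyUpTo-cong (λ j → block-map (ℕ.*-cancelʳ-≡ _ _ 2) j w) n) ⟩
      S (fromBlocks (length w) (blocks w n))
        ≡⟨ cong S (fromBlocks-blocks w w<n) ⟩
      S w ∎
      where
      odd-double : ∀ j → odd (j ℕ.* 2) ≡ 0
      odd-double zero    = ≡.refl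
      odd-double (suc j) = odd-double j
      odd-suc-double : ∀ j → odd (suc (j ℕ.* 2)) ≡ 1
      odd-suc-double zero    = ≡.refl
      odd-suc-double (suc j) = odd-suc-double j
      odd∉ : ∀ j → suc (j ℕ.* 2) ∉ map (ℕ._* 2) w
      odd∉ j j∈ with x , _ , eq ← ∈-map⁻ (ℕ._* 2) j∈ =
        case ≡.trans (≡.sym (odd-suc-double j)) (≡.trans (cong odd eq) (odd-double x)) of λ ()

    alternatingSeq-Sol : ∀ d → (∀ w → d < length w → S w ≈ 0#) → Sol (alternatingSeq S)
    alternatingSeq-Sol d S≈0 = ((d , bounded) , stable) , sol
      where
      -- Rebuilding a word from blocks keeps its length, so `S` vanishes on each term.
      bounded : ∀ n (w : Word n) → d < length w → alternatingSeq S n w ≈ 0#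
      bounded n w d< = trans
        (alternate⁺-cong (blocks (map toℕ w) n) (λ Bs → S≈0 _
          (subst (d <_) (≡.sym (≡.trans (length-fromBlocks (length (map toℕ w)) Bs) (List.length-map toℕ w))) d<)))
        (alternate⁺-0 (blocks (map toℕ w) n))

      stable : ∀ n w → substitute (killLast n) (alternatingSeq S (suc n)) w ≈ alternatingSeq S n w
      stable n w = begin
        substitute (killLast n) (alternatingSeq S (suc n)) w ≈⟨ substitute-killLast n (alternatingSeq S (suc n)) w ⟩
        evaluation S (suc n) (map toℕ (map inject₁ w))
          ≡⟨ cong (evaluation S (suc n)) (≡.trans (≡.sym (List.map-∘ w)) (List.map-cong Fin.toℕ-inject₁ w)) ⟩
        evaluation S (suc n) (map toℕ w)                     ≈⟨ evaluation-suc n (map toℕ w) (toℕ∈-< w) ⟩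
        evaluation S n (map toℕ w)                           ∎

      sol : SolCond (alternatingSeq S)
      sol m i w = begin
        substitute (mergeVar i) (alternatingSeq S (suc (suc m))) w
          ≈⟨ substitute≈∑ (mergeVar i) (preimage-mergeVar i) (alternatingSeq S (suc (suc m))) (λ _ → refl) w ⟩
        ∑ (choices (merge (toℕ i)) (map toℕ w)) (evaluation S (suc (suc m)))
          ≈⟨ subst (λ o → ∑ (choices (merge (toℕ i)) (map toℕ w)) (evaluation S (suc (suc o))) ≈
                          ∑ (choices (gap (toℕ i)) (map toℕ w)) (evaluation S o))
               (ℕ.m+[n∸m]≡n (ℕ.≤-pred (Fin.toℕ<n i))) (evaluation-merge (toℕ i) (m ∸ toℕ i) (map toℕ w)) ⟩
        ∑ (choices (gap (toℕ i)) (map toℕ w)) (evaluation S m)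
          ≈⟨ substitute≈∑ (skipTwo i) (preimage-skipTwo i) (alternatingSeq S m) (λ _ → refl) w ⟨
        substitute (skipTwo i) (alternatingSeq S m) w ∎

-- The isomorphism

skip₂-double : ∀ i x → skip₂ (i ℕ.* 2) (x ℕ.* 2) ≡ skip i x ℕ.* 2
skip₂-double zero    x       = ≡.refl
skip₂-double (suc i) zero    = ≡.refl
skip₂-double (suc i) (suc x) = cong (suc ∘ suc) (skip₂-double i x)

∈-choices-const : ∀ {L : List B} v → (∀ {x} → x ∈ v → x ∈ L) → ∀ (w : List A) → length w ≡ length v →
                  v ∈ choices (λ _ → L) w
∈-choices-const []      _   []      _   = here ≡.refl
∈-choices-const (x ∷ v) v⊆L (y ∷ w) len = ∈-concatMap⁺ _ (lose (v⊆L (here ≡.refl))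
  (∈-map⁺ (x ∷_) (∈-choices-const v (v⊆L ∘ there) w (ℕ.suc-injective len))))

-- Packing under monotone relabelling

module Packing (K : CommutativeRing 0ℓ 0ℓ) where
  open NC K using (pack; IsPacked)
  open ≡-Reasoning

  pack-map : ∀ {φ : ℕ → ℕ} → (∀ {x y} → x < y → φ x < φ y) → ∀ w → pack (map φ w) ≡ pack w
  pack-map {φ} φ-mono w = begin
    map (suc ∘ rank (map φ w)) (map φ w)      ≡⟨ List.map-∘ (map φ w) ⟩
    map suc (map (rank (map φ w)) (map φ w))  ≡⟨ cong (map suc) (StrictlyMonotone.map-rank-map φ φ-mono w) ⟩
    map suc (map (rank w) w)                  ≡⟨ List.map-∘ w ⟨
    map (suc ∘ rank w) w                      ∎

  length-pack : ∀ w → length (pack w) ≡ length w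
  length-pack w = List.length-map (suc ∘ rank w) w

  pack-map-skip : ∀ i w → pack (map (skip i) w) ≡ pack w
  pack-map-skip i = pack-map (skip-mono-< i)

  -- `pack` is itself skip invariant, so `map-rank` applies to it; the shift by `suc` is monotone
  -- and therefore invisible.
  pack-pack : ∀ w → pack (pack w) ≡ pack w
  pack-pack w = begin
    pack (map (suc ∘ rank w) w)      ≡⟨ cong pack (List.map-∘ w) ⟩
    pack (map suc (map (rank w) w))  ≡⟨ pack-map s≤s (map (rank w) w) ⟩
    pack (map (rank w) w)            ≡⟨ SkipInvariance.map-rank ≡.isEquivalence pack pack-map-skip w ⟩
    pack w                           ∎

  pack-isPacked : ∀ w → IsPacked (pack w)
  pack-isPacked w = All.map⁺ (All.tabulate (λ _ → s≤s z≤n)) , predecessor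
    where
    predecessor : ∀ j → 1 ≤ j → suc j ∈ pack w → j ∈ pack w
    predecessor (suc j) _ sj∈ =
      let x , _ , eq    = ∈-map⁻ (suc ∘ rank w) sj∈
          y , y∈w , eq′ = rank-surjective w x (ℕ.suc-injective (≡.sym eq))
      in subst (_∈ pack w) (cong suc eq′) (∈-map⁺ (suc ∘ rank w) y∈w)

module Isomorphism (K : CommutativeRing 0ℓ 0ℓ) where
  open Evaluation K
  open Packing K

  -- Expansion in packed words

  _≟_ = List.≡-dec ℕ._≟_

  indicator : List ℕ → List ℕ → Carrier
  indicator u v = if does (u ≟ v) then 1# else 0#

  indicator-refl : ∀ u → indicator u u ≈ 1#
  indicator-refl u rewrite dec-true (u ≟ u) ≡.refl = refl

  indicator-≢ : ∀ u v → u ≢ v → indicator u v ≈ 0#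
  indicator-≢ u v u≢v rewrite dec-false (u ≟ v) u≢v = refl

  ∑-indicator-∉ : ∀ (h : List ℕ → Carrier) u us → u ∉ us → ∑ us (λ v → h v * indicator u v) ≈ 0#
  ∑-indicator-∉ h u us u∉ = ∑-zero us λ {v} v∈ →
    trans (*-congˡ (indicator-≢ u v λ { ≡.refl → u∉ v∈ })) (zeroʳ _)

  ∑-indicator-∈ : ∀ (h : List ℕ → Carrier) u {us} → Unique us → u ∈ us → ∑ us (λ v → h v * indicator u v) ≈ h u
  ∑-indicator-∈ h u {v ∷ us} (v∉ ∷ _) (here ≡.refl) = begin
    h u * indicator u u + ∑ us (λ v → h v * indicator u v)
      ≈⟨ +-cong (*-congˡ (indicator-refl u)) (∑-indicator-∉ h u us (λ u∈ → All.lookup v∉ u∈ ≡.refl)) ⟩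
    h u * 1# + 0#  ≈⟨ +-identityʳ _ ⟩
    h u * 1#       ≈⟨ *-identityʳ _ ⟩
    h u            ∎
  ∑-indicator-∈ h u {v ∷ us} (v∉ ∷ us!) (there u∈) = begin
    h v * indicator u v + ∑ us (λ v → h v * indicator u v)
      ≈⟨ +-cong (*-congˡ (indicator-≢ u v (All.lookup v∉ u∈ ∘ ≡.sym))) (∑-indicator-∈ h u us! u∈) ⟩
    h v * 0# + h u  ≈⟨ +-congʳ (zeroʳ _) ⟩
    0# + h u        ≈⟨ +-identityˡ _ ⟩
    h u             ∎

  wordCoefficient : List (Carrier × List ℕ) → List ℕ → Carrier
  wordCoefficient ts w = ∑ ts (λ (a , u) → a * indicator (pack w) u)

  -- `Pu` reads letters from 1 and `wordCoefficient` from 0; packing does not see the difference.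
  linComb≈wordCoefficient : ∀ ts n (w : Word n) → linComb ts n w ≈ wordCoefficient ts (map toℕ w)
  linComb≈wordCoefficient []             n w = refl
  linComb≈wordCoefficient ((a , u) ∷ ts) n w = +-cong
    (reflexive (cong (λ v → a * indicator v u) (≡.trans (cong pack (List.map-∘ w)) (pack-map s≤s (map toℕ w)))))
    (linComb≈wordCoefficient ts n w)

  wordCoefficient-skip : ∀ ts → SkipInvariant (wordCoefficient ts)
  wordCoefficient-skip ts i w = ∑-cong ts (λ {(a , u)} _ →
    reflexive (cong (λ v → a * indicator v u) (pack-map-skip i w)))

  -- Packing preserves length, and the sum of the lengths bounds each of them.
  wordCoefficient-degree : ∀ ts w → sum (map (length ∘ proj₂) ts) < length w → wordCoefficient ts w ≈ 0#
  wordCoefficient-degree ts w d< = ∑-zero ts λ {(a , u)} t∈ →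
    trans (*-congˡ (indicator-≢ (pack w) u λ p≡u → ℕ.<⇒≱ d<
      (subst (_≤ sum (map (length ∘ proj₂) ts)) (≡.trans (cong length (≡.sym p≡u)) (length-pack w))
        (∈⇒≤sum _ (∈-map⁺ (length ∘ proj₂) t∈))))) (zeroʳ a)

  -- Contains every packed word of length at most d.
  candidates : ℕ → List (List ℕ)
  candidates d = concatMap (λ l → choices (λ _ → upTo (suc (suc d))) (upTo l)) (upTo (suc d))

  pack∈candidates : ∀ {d} w → length w ≤ d → pack w ∈ candidates d
  pack∈candidates {d} w w≤d = ∈-concatMap⁺ (λ l → choices (λ _ → upTo (suc (suc d))) (upTo l))
    (lose (∈-upTo⁺ (s≤s w≤d)) (∈-choices-const (pack w) small (upTo (length w))
      (≡.trans (List.length-upTo (length w)) (≡.sym (List.length-map _ w)))))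
    where
    -- The crude bound of a rank by the length of the word allows letters up to `suc d`, whence the
    -- alphabet `upTo (suc (suc d))`.
    small : ∀ {y} → y ∈ pack w → y ∈ upTo (suc (suc d))
    small y∈ with x , _ , ≡.refl ← ∈-map⁻ (suc ∘ rank w) y∈ =
      ∈-upTo⁺ (s≤s (s≤s (ℕ.≤-trans (rank≤length w x) w≤d)))

  -- Fixed points of `pack` are packed and, as `pack` is idempotent, include every packing; without
  -- repetitions each coefficient is counted once.
  packedWords : ℕ → List (List ℕ)
  packedWords d = deduplicate _≟_ (filter (λ v → pack v ≟ v) (candidates d))

  packedWords-isPacked : ∀ d {v} → v ∈ packedWords d → IsPacked v
  packedWords-isPacked d v∈ = subst IsPacked
    (proj₂ (∈-filter⁻ (λ v → pack v ≟ v) {xs = candidates d} (∈-deduplicate⁻ _≟_ _ v∈))) (pack-isPacked _)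

  pack∈packedWords : ∀ {d} w → length w ≤ d → pack w ∈ packedWords d
  pack∈packedWords w w≤d =
    ∈-deduplicate⁺ _≟_ (∈-filter⁺ (λ v → pack v ≟ v) (pack∈candidates w w≤d) (pack-pack w))

  module _ {G : List ℕ → Carrier} (G-skip : SkipInvariant G)
           (d : ℕ) (G≈0 : ∀ w → d < length w → G w ≈ 0#) where

    -- The coefficient of `Pu u` is the value of `G` at `u` itself, lowered by one because `G` reads
    -- letters from 0.
    expansion : List (Carrier × List ℕ)
    expansion = map (λ u → G (map ℕ.pred u) , u) (packedWords d)

    expansion-coefficient : ∀ w → wordCoefficient expansion w ≈ G w
    expansion-coefficient w with Any.any? (pack w ≟_) (packedWords d)
    ... | yes p∈ = begin
      wordCoefficient expansion w  ≈⟨ ∑-map _ (packedWords d) _ ⟩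
      ∑ (packedWords d) (λ u → G (map ℕ.pred u) * indicator (pack w) u)
        ≈⟨ ∑-indicator-∈ (G ∘ map ℕ.pred) (pack w)
             (deduplicate-! _≟_ (filter (λ v → pack v ≟ v) (candidates d))) p∈ ⟩
      G (map ℕ.pred (pack w))      ≡⟨ cong G (List.map-∘ w) ⟨
      G (map (rank w) w)           ≈⟨ SkipInvariance.map-rank isEquivalence G G-skip w ⟩
      G w                          ∎
    ... | no p∉ = begin
      wordCoefficient expansion w  ≈⟨ ∑-map _ (packedWords d) _ ⟩
      ∑ (packedWords d) (λ u → G (map ℕ.pred u) * indicator (pack w) u)
        ≈⟨ ∑-indicator-∉ (G ∘ map ℕ.pred) (pack w) (packedWords d) p∉ ⟩
      0#                           ≈⟨ G≈0 w (ℕ.≰⇒> (p∉ ∘ pack∈packedWords w)) ⟨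
      G w                          ∎

  -- Restriction to the even letters

  double : ∀ {n} → Fin n → Fin (n ℕ.* 2)
  double x = Fin.combine x (Fin.zero {1})

  toℕ-double : ∀ {n} (x : Fin n) → toℕ (double x) ≡ toℕ x ℕ.* 2
  toℕ-double x = ≡.trans (Fin.toℕ-combine x (Fin.zero {1})) (≡.trans (ℕ.+-identityʳ _) (ℕ.*-comm 2 (toℕ x)))

  map-toℕ-double : ∀ {n} (w : Word n) → map toℕ (map double w) ≡ map (ℕ._* 2) (map toℕ w)
  map-toℕ-double w = ≡.trans (≡.sym (List.map-∘ w)) (≡.trans (List.map-cong toℕ-double w) (List.map-∘ w))

  restrict : Seq → Seq
  restrict P n w = P (n ℕ.* 2) (map double w)

  evenExtension : Seq → List ℕ → Carrier
  evenExtension P w = extension P (map (ℕ._* 2) w)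

  restrict-extends : ∀ {P} → IsStable P → Extends (evenExtension P) (restrict P)
  restrict-extends {P} stable n w =
    trans (extends stable (n ℕ.* 2) (map double w)) (reflexive (cong (extension P) (map-toℕ-double w)))

  restrict-InWQSym : ∀ P → Sol P → InWQSym (restrict P)
  restrict-InWQSym P (stable@((d , P≈0) , _) , sol) =
    ts , All.map⁺ (All.tabulate (packedWords-isPacked d)) , λ n w → begin
      restrict P n w                     ≈⟨ restrict-extends stable n w ⟩
      evenExtension P (map toℕ w)        ≈⟨ expansion-coefficient even-skip d even≈0 (map toℕ w) ⟨
      wordCoefficient ts (map toℕ w)     ≈⟨ linComb≈wordCoefficient ts n w ⟨
      linComb ts n w                     ∎
    where
    even-skip : SkipInvariant (evenExtension P)
    even-skip i w = begin
      extension P (map (ℕ._* 2) (map (skip i) w))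
        ≡⟨ cong (extension P) (≡.trans (≡.sym (List.map-∘ w))
             (≡.trans (List.map-cong (λ x → ≡.sym (skip₂-double i x)) w) (List.map-∘ w))) ⟩
      extension P (map (skip₂ (i ℕ.* 2)) (map (ℕ._* 2) w))
        ≈⟨ balanced-skip₂ (extension-balanced stable sol) (i ℕ.* 2) (map (ℕ._* 2) w) ⟩
      extension P (map (ℕ._* 2) w) ∎
    even≈0 : ∀ w → d < length w → evenExtension P w ≈ 0#
    even≈0 w d< = P≈0 _ _ (subst (d <_)
      (≡.sym (≡.trans (List.length-map _ (map (ℕ._* 2) w)) (List.length-map _ w))) d<)
    ts = expansion even-skip d even≈0

  restrict-injective : ∀ P Q → Sol P → Sol Q → restrict P ≋ restrict Q → P ≋ Q
  restrict-injective P Q (P-stable , P-sol) (Q-stable , Q-sol) eq n w = begin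
    P n w                       ≈⟨ extends P-stable n w ⟩
    extension P (map toℕ w)     ≈⟨ balanced-unique (extension-balanced P-stable P-sol)
                                     (extension-balanced Q-stable Q-sol) even (map toℕ w) ⟩
    extension Q (map toℕ w)     ≈⟨ extends Q-stable n w ⟨
    Q n w                       ∎
    where
    even : ∀ v → evenExtension P v ≈ evenExtension Q v
    even v = begin
      evenExtension P v             ≡⟨ cong (evenExtension P) toℕu ⟨
      evenExtension P (map toℕ u)   ≈⟨ restrict-extends P-stable _ u ⟨
      restrict P _ u                ≈⟨ eq _ u ⟩
      restrict Q _ u                ≈⟨ restrict-extends Q-stable _ u ⟩
      evenExtension Q (map toℕ u)   ≡⟨ cong (evenExtension Q) toℕu ⟩
      evenExtension Q v             ∎
      where
      -- The hypothesis concerns finitely many variables at a time; `u` is `v` placed among enough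
      -- of them.
      u    = map (clamp (sum v)) v
      toℕu = map-toℕ-clamp v (∈⇒≤sum v)

  restrict-surjective : ∀ S → InWQSym S → ∃ λ P → Sol P × restrict P ≋ S
  restrict-surjective S (ts , _ , S≈) =
    alternatingSeq G , alternatingSeq-Sol (wordCoefficient-skip ts) _ (wordCoefficient-degree ts) , λ n w → begin
      evaluation G (n ℕ.* 2) (map toℕ (map double w))       ≡⟨ cong (evaluation G (n ℕ.* 2)) (map-toℕ-double w) ⟩
      evaluation G (n ℕ.* 2) (map (ℕ._* 2) (map toℕ w))
        ≈⟨ evaluation-even (wordCoefficient-skip ts) n (map toℕ w) (toℕ∈-< w) ⟩
      G (map toℕ w)                                         ≈⟨ linComb≈wordCoefficient ts n w ⟨
      linComb ts n w                                        ≈⟨ S≈ n w ⟨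
      S n w                                                 ∎
    where G = wordCoefficient ts

  splits-map : ∀ (h : A → B) w → splits (map h w) ≡ map (λ (u , v) → map h u , map h v) (splits w)
  splits-map h []      = ≡.refl
  splits-map h (x ∷ w) = cong (([] , h x ∷ map h w) ∷_) (≡.trans (cong (map _) (splits-map h w))
    (≡.trans (≡.sym (List.map-∘ (splits w))) (List.map-∘ (splits w))))

  restrict-⊛ : ∀ P Q → restrict (P ⊛ Q) ≋ (restrict P ⊛ restrict Q)
  restrict-⊛ P Q n w = trans
    (reflexive (cong (λ ss → ∑ ss (λ s → P (n ℕ.* 2) (proj₁ s) * Q (n ℕ.* 2) (proj₂ s))) (splits-map double w)))
    (∑-map _ (splits w) _)

  algIsoSolWQSym : AlgIsoSolWQSym
  algIsoSolWQSym = record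
    { f      = λ P _ → restrict P
    ; f-into = restrict-InWQSym
    ; f-resp = λ P Q _ _ eq n w → eq (n ℕ.* 2) (map double w)
    ; f-inj  = restrict-injective
    ; f-surj = restrict-surjective
    ; f-⊕    = λ P Q _ _ _ n w → refl
    ; f-•    = λ a P _ _ n w → refl
    ; f-⊛    = λ P Q _ _ _ → restrict-⊛ P Q
    ; f-𝟙    = λ { _ n [] → refl ; _ n (_ ∷ _) → refl }
    }

theorem1p2 : (K : CommutativeRing 0ℓ 0ℓ) → FieldProps.IsAlgClosedChar0Field K →
    NC.SolIsSubalgebra K × NC.AlgIsoSolWQSym K
theorem1p2 K _ = Solutions.solIsSubalgebra K , Isomorphism.algIsoSolWQSym K
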